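{- For all $d,k\in\mathbb{N}$, all topologies $G,G'$, all process templates $P\in\mathcal{P}_u$, all $k$-tuples $\bar g$ of distinct vertices of $G$ and all $k$-tuples $\bar g'$ of distinct vertices of $G'$: if $T(G,\bar g)\equiv_{\mathsf{CTL}^*_d\setminus\mathsf{X}}T(G',\bar g')$, then $P^G|_{\bar g}\equiv_{\mathsf{CTL}^*_d\setminus\mathsf{X}}P^{G'}|_{\bar g'}$.
   Context: A process template $P\in\mathcal{P}_u$ is a finite LTS over atoms $\mathsf{AP}_{pr}$ with action labels $\Sigma_{int}\cup\{\mathsf{snd},\mathsf{rcv}\}$ ($\Sigma_{int}$ finite nonempty), states partitioned into nonempty token states $T$ and non-token states $N$, initial states $\{\iota_t,\iota_n\}$ with $\iota_t\in T,\iota_n\in N$, $\mathsf{snd}$-transitions from $T$ to $N$, $\mathsf{rcv}$-transitions from $N$ to $T$, internal transitions staying within $T$ or within $N$, every state having a successor, and every infinite action sequence in $(\Sigma_{int}^*\mathsf{snd}\Sigma_{int}^*\mathsf{rcv})^\omega\cup(\Sigma_{int}^*\mathsf{rcv}\Sigma_{int}^*\mathsf{snd})^\omega$. A topology is $G=(V,E,x)$, $V=[n]$, $x\in V$ initial, $E\subseteq V\times V$ irreflexive. The token-passing system $P^G$ has states $Q^V$, initial state with $x$ in $\iota_t$ and all other vertices in $\iota_n$, labeling $p_i$ iff $p$ holds in the local state of $i$, internal transitions (one vertex takes an internal local transition, others unchanged) and token-passing transitions along edges $(v,w)\in E$ ($v$ takes an $\mathsf{snd}$ local transition and $w$ a $\mathsf{rcv}$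 local transition simultaneously, others unchanged). Projection $P^G|_{\bar g}$: the LTS $P^G$ relabeled by $L(s)=\{p@i:p_{g_i}\in\Lambda(s),i\in[k]\}$. Graph LTS $T(G,\bar g)$: states $V$, initial state $x$, one action, transitions exactly the edges of $G$, label $\{i\}$ at $g_i$ and $\emptyset$ elsewhere. $\mathsf{CTL}^*_d\setminus\mathsf{X}$ is $\mathsf{CTL}^*$ without the next-time operator with path-quantifier nesting depth at most $d$; $M\equiv_{\mathsf{CTL}^*_d\setminus\mathsf{X}}N$ means $M$ and $N$ (from their initial states) satisfy the same such formulas. -}

module Defs where

open import Data.Nat using (ℕ; zero; suc; _+_; _<_; _≤_; _⊔_)
open import Data.Fin using (Fin; _≟_)
open import Data.Bool using (Bool; true; false; if_then_else_)
open import Data.Product using (Σ; ∃; ∃-syntax; _×_; _,_)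
open import Data.Sum using (_⊎_)
open import Relation.Nullary using (¬_; does)
open import Relation.Binary.PropositionalEquality using (_≡_; _≢_)
open import Function.Bundles using (_⇔_)
open import Function.Definitions using (Injective)
open import Data.Nat.Properties using (+-suc)
open import Data.Unit using (⊤)

-- Kripke-style LTS (actions are irrelevant for CTL* semantics, so the
-- transition relation forgets them).  Atoms of type AP, labels Bool-valued.

record LTS (AP : Set) : Set₁ where
  field
    State : Set
    init  : State
    Step  : State → State → Set
    label : State → AP → Bool

mutual
  data StateF (AP : Set) : Set where
    tt   : StateF AP
    atom : AP → StateF AP
    ¬ₛ_  : StateF AP → StateF AP
    _∧ₛ_ : StateF AP → StateF AP → StateF AP
    E    : PathF AP → StateF AP

  data PathF (AP : Set) : Set where
    st   : StateF AP → PathF AP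
    ¬ₚ_  : PathF AP → PathF AP
    _∧ₚ_ : PathF AP → PathF AP → PathF AP
    _U_  : PathF AP → PathF AP → PathF AP

mutual
  depthS : {AP : Set} → StateF AP → ℕ
  depthS tt = 0
  depthS (atom p) = 0
  depthS (¬ₛ φ) = depthS φ
  depthS (φ ∧ₛ ψ) = depthS φ ⊔ depthS ψ
  depthS (E φ) = suc (depthP φ)

  depthP : {AP : Set} → PathF AP → ℕ
  depthP (st φ) = depthS φ
  depthP (¬ₚ φ) = depthP φ
  depthP (φ ∧ₚ ψ) = depthP φ ⊔ depthP ψ
  depthP (φ U ψ) = depthP φ ⊔ depthP ψ

module _ {AP : Set} (M : LTS AP) where
  open LTS M

  record Path : Set where
    constructor mkPath
    field
      at   : ℕ → State
      step : ∀ i → Step (at i) (at (suc i))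

  suffix : Path → ℕ → Path
  suffix (mkPath f s) j = mkPath (λ i → f (j + i)) (λ i → s' i)
    where
      s' : ∀ i → Step (f (j + i)) (f (j + suc i))
      s' i rewrite +-suc j i = s (j + i)

  mutual
    _⊨ₛ_ : State → StateF AP → Set
    s ⊨ₛ tt = ⊤
    s ⊨ₛ atom p = label s p ≡ true
    s ⊨ₛ (¬ₛ φ) = ¬ (s ⊨ₛ φ)
    s ⊨ₛ (φ ∧ₛ ψ) = (s ⊨ₛ φ) × (s ⊨ₛ ψ)
    s ⊨ₛ E φ = Σ Path (λ π → (Path.at π 0 ≡ s) × (π ⊨ₚ φ))

    _⊨ₚ_ : Path → PathF AP → Set
    π ⊨ₚ st φ = Path.at π 0 ⊨ₛ φ
    π ⊨ₚ (¬ₚ φ) = ¬ (π ⊨ₚ φ)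
    π ⊨ₚ (φ ∧ₚ ψ) = (π ⊨ₚ φ) × (π ⊨ₚ ψ)
    π ⊨ₚ (φ U ψ) = ∃[ j ] ((suffix π j ⊨ₚ ψ) × (∀ i → i < j → suffix π i ⊨ₚ φ))

  Sat : StateF AP → Set
  Sat φ = init ⊨ₛ φ

CTLd-equiv : {AP : Set} → ℕ → LTS AP → LTS AP → Set
CTLd-equiv {AP} d M N = (φ : StateF AP) → depthS φ ≤ d → (Sat M φ ⇔ Sat N φ)

data Act (m : ℕ) : Set where
  int : Fin m → Act m
  snd : Act m
  rcv : Act m

isInt : {m : ℕ} → Act m → Bool
isInt (int _) = true
isInt snd = false
isInt rcv = false

-- An ω-word w over Σ_int ∪ {snd,rcv} lies in (Σ_int* a Σ_int* b)^ω iff the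
-- positions of non-internal letters form a strictly increasing sequence t
-- with letters a, b, a, b, ... at t 0, t 1, t 2, ...
InOmega : {m : ℕ} → Act m → Act m → (ℕ → Act m) → Set
InOmega a b w =
  Σ (ℕ → ℕ) λ t →
    (∀ j → t j < t (suc j)) ×
    (∀ j → w (t (j + j)) ≡ a) ×
    (∀ j → w (t (suc (j + j))) ≡ b) ×
    (∀ n → (isInt (w n) ≡ true) ⊎ (∃[ j ] t j ≡ n))

record ProcTemplate (AP : Set) : Set where
  field
    nQ   : ℕ
    mInt : ℕ                         -- Σ_int = Fin (suc mInt) (finite, nonempty)
    δ    : Fin nQ → Act (suc mInt) → Fin nQ → Bool
    λP   : Fin nQ → AP → Bool
    tok  : Fin nQ → Bool             -- true: token state (T), false: N
    ιt ιn : Fin nQ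
    ιt-tok : tok ιt ≡ true
    ιn-ntok : tok ιn ≡ false
    snd-TN : ∀ q q' → δ q snd q' ≡ true → (tok q ≡ true) × (tok q' ≡ false)
    rcv-NT : ∀ q q' → δ q rcv q' ≡ true → (tok q ≡ false) × (tok q' ≡ true)
    int-same : ∀ q a q' → δ q (int a) q' ≡ true → tok q ≡ tok q'
    total : ∀ q → ∃[ a ] ∃[ q' ] δ q a q' ≡ true
    runs-ok : (ρ : ℕ → Fin nQ) (α : ℕ → Act (suc mInt)) →
              ((ρ 0 ≡ ιt) ⊎ (ρ 0 ≡ ιn)) →
              (∀ i → δ (ρ i) (α i) (ρ (suc i)) ≡ true) →
              InOmega snd rcv α ⊎ InOmega rcv snd α

record Topology : Set where
  field
    n   : ℕ
    Edge : Fin n → Fin n → Bool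
    x   : Fin n
    irrefl : ∀ v → Edge v v ≡ false

_==_ : {n : ℕ} → Fin n → Fin n → Bool
u == v = does (u ≟ v)

module _ {AP : Set} (P : ProcTemplate AP) (G : Topology) where
  open ProcTemplate P
  open Topology G

  GState : Set
  GState = Fin n → Fin nQ

  GInit : GState
  GInit v = if v == x then ιt else ιn

  data GStep (s s' : GState) : Set where
    internal : (v : Fin n) (a : Fin (suc mInt)) →
               δ (s v) (int a) (s' v) ≡ true →
               (∀ u → u ≢ v → s' u ≡ s u) → GStep s s'
    pass     : (v w : Fin n) → Edge v w ≡ true →
               δ (s v) snd (s' v) ≡ true →
               δ (s w) rcv (s' w) ≡ true →
               (∀ u → u ≢ v → u ≢ w → s' u ≡ s u) → GStep s s'

  -- projection P^G|_g : atoms p@i (p ∈ AP_pr, i ∈ [k]) encoded as (p , i)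
  Proj : {k : ℕ} → (Fin k → Fin n) → LTS (AP × Fin k)
  Proj g = record
    { State = GState
    ; init  = GInit
    ; Step  = GStep
    ; label = λ s pi → λP (s (g (Data.Product.proj₂ pi))) (Data.Product.proj₁ pi)
    }

GraphLTS : (G : Topology) {k : ℕ} → (Fin k → Fin (Topology.n G)) → LTS (Fin k)
GraphLTS G g = record
  { State = Fin n
  ; init  = x
  ; Step  = λ v w → Edge v w ≡ true
  ; label = λ v i → g i == v
  }
  where open Topology G

{-# OPTIONS --safe #-}
-- The token of P^G performs a walk in G, and between two passes the unobserved processes can always be
-- driven, by invisible internal steps, to a state in which they can send or receive the token. Hence
-- global states are related at level e when the observed processes agree and the vertices holding the
-- token satisfy the same formulas of depth ≤ e; this relation preserves the formulas of depth ≤ e.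
--
-- For E φ at level e + 1, satisfaction in the finite system P^G is decided by a tableau, so one may argue
-- under double negation and start from a lasso-shaped run. Its token walk is described up to stuttering by
-- an E-formula over G, a chain of untils between characteristic formulas of the level-e classes that goes
-- through the loop of the lasso as many times as G' has vertices. The same formula holds in G', and by the
-- pigeonhole principle a vertex of G' recurs at the beginnings of laps, which yields a matching lasso in G'.
-- If the matching lap does not move the token of G', the loop stays in one class, and the chain is ended
-- with "always in this class" instead. Along the matching walk of G' the run is simulated in P^G'.

module Submission where

open import Defs
open import Data.Bool using (Bool; true; false)
import Data.Bool.Properties as Bool
open import Data.Empty using (⊥)
open import Data.Fin as Fin using (Fin; zero; suc; _≟_)
open import Data.Fin.Properties using (any?; all?; pigeonhole)
open import Data.List using (List; []; _∷_; allFin; cartesianProduct; map)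
open import Data.List.Membership.Propositional using (_∈_; find; lose)
open import Data.List.Membership.Propositional.Properties using (∈-allFin; ∈-cartesianProduct⁺; ∈-map⁺)
open import Data.List.Relation.Unary.All as All using ([]; _∷_)
open import Data.List.Relation.Unary.Any as Any using (here; there)
open import Data.Nat using (ℕ; zero; suc; _+_; _<_; _≤_; _⊔_; z≤n; s≤s; _≤′_; ≤′-refl; ≤′-step)
open import Data.Nat.Properties using
  (+-suc; +-identityʳ; +-assoc; ≤-refl; ≤-trans; n≤1+n; m≤m+n; ≤⇒≤′;
   m⊔n≤o⇒m≤o; m⊔n≤o⇒n≤o; ⊔-lub; m≤m⊔n; m≤n⊔m)
open import Data.Product using (Σ; ∃; ∃-syntax; _×_; _,_; proj₁; proj₂)
open import Data.Sum using (_⊎_; inj₁; inj₂; [_,_]′)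
open import Data.Unit using (⊤; tt)
open import Data.Vec using (Vec; []; _∷_; lookup; tabulate; _[_]≔_)
open import Data.Vec.Properties using
  (lookup∘tabulate; tabulate∘lookup; tabulate-cong; lookup∘update; lookup∘update′)
open import Function using (_∘_; flip; id)
open import Function.Bundles using (_⇔_; Equivalence; mk⇔)
open import Function.Definitions using (Injective)
open import Function.Properties.Equivalence using () renaming (sym to ⇔-sym)
open import Relation.Binary.Construct.Closure.ReflexiveTransitive using (Star; ε; _◅_; _◅◅_)
open import Relation.Binary.PropositionalEquality using (_≡_; _≢_; refl; sym; trans; cong; subst; subst₂)
open import Relation.Nullary using (¬_; Dec; yes; no; contradiction)
open import Relation.Nullary.Decidable using
  (¬?; ¬¬-excluded-middle; _×-dec_; _⊎-dec_; _→-dec_; map′; decidable-stable; dec-true)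

open Equivalence using (to; from)

-- Double negation and finite types.

_>>=_ : {A B : Set} → ¬ ¬ A → (A → ¬ ¬ B) → ¬ ¬ B
(m >>= f) k = m λ a → f a k

return : {A : Set} → A → ¬ ¬ A
return a k = k a

record Finite (A : Set) : Set where
  field
    elems    : List A
    complete : ∀ a → a ∈ elems

open Finite

module _ {A : Set} (fin : Finite A) {P : A → Set} where

  ∃? : (∀ a → Dec (P a)) → Dec (∃ P)
  ∃? P? = map′ (λ w → let a , _ , p = find w in a , p)
               (λ (a , p) → lose (complete fin a) p)
               (Any.any? P? (elems fin))

  ¬¬-∀ : (∀ a → ¬ ¬ P a) → ¬ ¬ (∀ a → P a)
  ¬¬-∀ f = go (elems fin) >>= λ ps → return λ a → All.lookup ps (complete fin a)
    where
    go : ∀ xs → ¬ ¬ (All.All P xs)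
    go []       = return []
    go (x ∷ xs) = f x >>= λ p → go xs >>= λ ps → return (p ∷ ps)

finite-Fin : ∀ n → Finite (Fin n)
finite-Fin n = record { elems = allFin n ; complete = ∈-allFin }

finite-Bool : Finite Bool
finite-Bool = record { elems    = true ∷ false ∷ []
                     ; complete = λ { true → here refl ; false → there (here refl) } }

finite-⊤ : Finite ⊤
finite-⊤ = record { elems = tt ∷ [] ; complete = λ _ → here refl }

finite-× : {A B : Set} → Finite A → Finite B → Finite (A × B)
finite-× fa fb = record
  { elems    = cartesianProduct (elems fa) (elems fb)
  ; complete = λ (a , b) → ∈-cartesianProduct⁺ (complete fa a) (complete fb b) }

finite-map : {A B : Set} (f : A → B) (g : B → A) → (∀ b → f (g b) ≡ b) → Finite A → Finite B
finite-map f g fg fa = record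
  { elems    = map f (elems fa)
  ; complete = λ b → subst (_∈ _) (fg b) (∈-map⁺ f (complete fa (g b))) }

finite-Vec : {A : Set} → Finite A → ∀ n → Finite (Vec A n)
finite-Vec fa zero    = finite-map (λ _ → []) (λ _ → tt) (λ { [] → refl }) finite-⊤
finite-Vec fa (suc n) = finite-map (λ (a , as) → a ∷ as) (λ { (a ∷ as) → a , as })
                                   (λ { (_ ∷ _) → refl }) (finite-× fa (finite-Vec fa n))

-- Walks and their infinite unfolding

record Star⁺ {J : Set} (R : J → J → Set) (x z : J) : Set where
  constructor _◂_
  field
    {mid} : J
    first : R x mid
    rest  : Star R mid z

⁺⇒* : {J : Set} {R : J → J → Set} {x y : J} → Star⁺ R x y → Star R x y
⁺⇒* (r ◂ rs) = r ◅ rs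

_⁺◅◅_ : {J : Set} {R : J → J → Set} {x y z : J} → Star⁺ R x y → Star R y z → Star⁺ R x z
(r ◂ rs) ⁺◅◅ ss = r ◂ (rs ◅◅ ss)

_◅◅⁺_ : {J : Set} {R : J → J → Set} {x y z : J} → Star R x y → Star⁺ R y z → Star⁺ R x z
ε        ◅◅⁺ s = s
(r ◅ rs) ◅◅⁺ s = r ◂ (rs ◅◅ ⁺⇒* s)

module _ {J : Set} {R : J → J → Set} (Q : J → J → Set) where

  data AnyEdge : ∀ {x y} → Star R x y → Set where
    here  : ∀ {x y z} {r : R x y} {rs : Star R y z} → Q x y → AnyEdge (r ◅ rs)
    there : ∀ {x y z} {r : R x y} {rs : Star R y z} → AnyEdge rs → AnyEdge (r ◅ rs)

  data AllEdges : ∀ {x y} → Star R x y → Set where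
    []  : ∀ {x} → AllEdges {x} ε
    _∷_ : ∀ {x y z} {r : R x y} {rs : Star R y z} → Q x y → AllEdges rs → AllEdges (r ◅ rs)

module _ {J : Set} {R : J → J → Set} {Q : J → J → Set} where

  any-++ˡ : ∀ {x y z} {rs : Star R x y} (ss : Star R y z) → AnyEdge Q rs → AnyEdge Q (rs ◅◅ ss)
  any-++ˡ ss (here q)  = here q
  any-++ˡ ss (there a) = there (any-++ˡ ss a)

  any-++ʳ : ∀ {x y z} (rs : Star R x y) {ss : Star R y z} → AnyEdge Q ss → AnyEdge Q (rs ◅◅ ss)
  any-++ʳ ε        a = a
  any-++ʳ (_ ◅ rs) a = there (any-++ʳ rs a)

  any-⁺◅◅ : ∀ {x y z} (rs : Star⁺ R x y) (ss : Star R y z) →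
            AnyEdge Q (⁺⇒* rs) → AnyEdge Q (⁺⇒* (rs ⁺◅◅ ss))
  any-⁺◅◅ (_ ◂ _) ss = any-++ˡ ss

  any-◅◅⁺ : ∀ {x y z} (rs : Star R x y) {s : Star⁺ R y z} →
            AnyEdge Q (⁺⇒* s) → AnyEdge Q (⁺⇒* (rs ◅◅⁺ s))
  any-◅◅⁺ ε        a = a
  any-◅◅⁺ (_ ◅ rs) a = there (any-++ʳ rs a)

-- Until as an inductive predicate on positions, so that proofs recurse on the derivation and no
-- suffix has to be formed.
data Until (A B : ℕ → Set) (i : ℕ) : Set where
  here  : B i → Until A B i
  there : A i → Until A B (suc i) → Until A B i

Eventually : (ℕ → Set) → ℕ → Set
Eventually B = Until (λ _ → ⊤) B

eventually-map : {B B' : ℕ → Set} → (∀ i → B i → B' i) → ∀ {i} → Eventually B i → Eventually B' i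
eventually-map f (here b)     = here (f _ b)
eventually-map f (there tt u) = there tt (eventually-map f u)

-- Infinite concatenation of nonempty walks, one lap for each key. `K = ⊤` unfolds a lasso; a larger
-- `K` lets a lap depend on what the earlier laps have reached.
module Unfold {J K : Set} {R : J → J → Set} (st : K → J) (next : K → K)
              (lap : ∀ k → Star⁺ R (st k) (st (next k))) where

  record Config : Set where
    constructor config
    field
      key  : K
      pos  : J
      rest : Star R pos (st key)

  open Config public

  advance : Config → Config
  advance (config k _ ε)        = config (next k) _ (Star⁺.rest (lap k))
  advance (config k _ (_ ◅ rs)) = config k _ rs

  edge : ∀ c → R (pos c) (pos (advance c))
  edge (config k _ ε)       = Star⁺.first (lap k)
  edge (config _ _ (r ◅ _)) = r

  run : Config → ℕ → Config
  run c zero    = c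
  run c (suc i) = advance (run c i)

  module _ (c₀ : Config) where

    at : ℕ → J
    at i = pos (run c₀ i)

    -- The rest of the current walk is used up first, and the lap after it contains an edge in `Q`.
    -- The recursion is on these walks; the equation on `run` ties them to positions.
    visits : {Q : J → J → Set} → (∀ k → AnyEdge Q (⁺⇒* (lap k))) → ∀ i → Eventually (λ j → Q (at j) (at (suc j))) i
    visits {Q} hit i = rests i (rest (run c₀ i)) refl
      where
      hit-here : ∀ i {c} → run c₀ i ≡ c → Q (pos c) (pos (advance c)) → Q (at i) (at (suc i))
      hit-here i eq = subst (λ c → Q (pos c) (pos (advance c))) (sym eq)

      walk : ∀ i {k y} (rs : Star R y (st k)) → AnyEdge Q rs → run c₀ i ≡ config k y rs →
             Eventually (λ j → Q (at j) (at (suc j))) i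
      walk i (r ◅ rs) (here q)  eq = here (hit-here i eq q)
      walk i (r ◅ rs) (there a) eq = there tt (walk (suc i) rs a (cong advance eq))

      laps : ∀ i k → AnyEdge Q (⁺⇒* (lap k)) → run c₀ i ≡ config k _ ε →
             Eventually (λ j → Q (at j) (at (suc j))) i
      laps i k (here q)  eq = here (hit-here i eq q)
      laps i k (there a) eq = there tt (walk (suc i) _ a (cong advance eq))

      rests : ∀ i {k y} (rs : Star R y (st k)) → run c₀ i ≡ config k y rs →
              Eventually (λ j → Q (at j) (at (suc j))) i
      rests i ε        eq = laps i _ (hit _) eq
      rests i (r ◅ rs) eq = there tt (rests (suc i) rs (cong advance eq))

  stays : {Q : J → J → Set} → (∀ k → AllEdges Q (⁺⇒* (lap k))) →
          ∀ c → AllEdges Q (rest c) → Q (pos c) (pos (advance c)) × AllEdges Q (rest (advance c))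
  stays all (config k _ ε)       []       with all k
  ... | q ∷ qs = q , qs
  stays all (config _ _ (r ◅ _)) (q ∷ qs) = q , qs

-- A stuttering condition on a correspondence of positions: the second sequence makes finitely many
-- steps, possibly none, while related to `i`, and arrives at a position related to `suc i`.
data Leads (C : ℕ → ℕ → Set) (i j : ℕ) : Set where
  done : C (suc i) j → Leads C i j
  wait : C i j → Leads C i (suc j) → Leads C i j

module _ {C : ℕ → ℕ → Set} (leads : ∀ {i j} → C i j → Leads C i j) {A B A' B' : ℕ → Set}
         (fa : ∀ {i j} → C i j → A i → A' j) (fb : ∀ {i j} → C i j → B i → B' j) where

  until-transfer : ∀ {i j} → C i j → Until A B i → Until A' B' j
  until-lead : ∀ {i j} → A i → Until A B (suc i) → Leads C i j → Until A' B' j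

  until-transfer c (here b)    = here (fb c b)
  until-transfer c (there a u) = until-lead a u (leads c)

  until-lead a u (done c)   = until-transfer c u
  until-lead a u (wait c l) = there (fa c a) (until-lead a u l)

-- Path formulas over sequences

module _ {AP : Set} where

  -- State formulas are opaque leaves here: `L i χ` stands for the truth of `χ` at position `i`, so
  -- different systems can share one sequence of positions.
  Holds : (ℕ → StateF AP → Set) → PathF AP → ℕ → Set
  Holds L (st χ)   i = L i χ
  Holds L (¬ₚ φ)   i = ¬ Holds L φ i
  Holds L (φ ∧ₚ ψ) i = Holds L φ i × Holds L ψ i
  Holds L (φ U ψ)    = Until (Holds L φ) (Holds L ψ)

  Leaves : (StateF AP → Set) → PathF AP → Set
  Leaves Q (st χ)   = Q χ
  Leaves Q (¬ₚ φ)   = Leaves Q φ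
  Leaves Q (φ ∧ₚ ψ) = Leaves Q φ × Leaves Q ψ
  Leaves Q (φ U ψ)  = Leaves Q φ × Leaves Q ψ

  leaves : {Q : StateF AP → Set} → (∀ χ → Q χ) → ∀ φ → Leaves Q φ
  leaves q (st χ)   = q χ
  leaves q (¬ₚ φ)   = leaves q φ
  leaves q (φ ∧ₚ ψ) = leaves q φ , leaves q ψ
  leaves q (φ U ψ)  = leaves q φ , leaves q ψ

  leaves-map : ∀ φ {Q Q' : StateF AP → Set} → (∀ χ → Q χ → Q' χ) → Leaves Q φ → Leaves Q' φ
  leaves-map (st χ)   h q       = h χ q
  leaves-map (¬ₚ φ)   h q       = leaves-map φ h q
  leaves-map (φ ∧ₚ ψ) h (q , r) = leaves-map φ h q , leaves-map ψ h r
  leaves-map (φ U ψ)  h (q , r) = leaves-map φ h q , leaves-map ψ h r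

  leaves-≤ : {Q : StateF AP → Set} {d : ℕ} → (∀ χ → depthS χ ≤ d → Q χ) →
             ∀ φ → depthP φ ≤ d → Leaves Q φ
  leaves-≤ q (st χ)   le = q χ le
  leaves-≤ q (¬ₚ φ)   le = leaves-≤ q φ le
  leaves-≤ q (φ ∧ₚ ψ) le = leaves-≤ q φ (m⊔n≤o⇒m≤o _ _ le) , leaves-≤ q ψ (m⊔n≤o⇒n≤o _ _ le)
  leaves-≤ q (φ U ψ)  le = leaves-≤ q φ (m⊔n≤o⇒m≤o _ _ le) , leaves-≤ q ψ (m⊔n≤o⇒n≤o _ _ le)

  module _ {L L' : ℕ → StateF AP → Set} {C : ℕ → ℕ → Set}
           (fwd : ∀ {i j} → C i j → Leads C i j) (bwd : ∀ {i j} → C i j → Leads (flip C) j i) where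

    -- The absence of the next-time operator enters here: an until is transferred once each sequence
    -- can be advanced while the other one follows by stuttering.
    stutter-invariance : ∀ φ → Leaves (λ χ → ∀ {i j} → C i j → L i χ ⇔ L' j χ) φ →
                         ∀ {i j} → C i j → Holds L φ i ⇔ Holds L' φ j
    stutter-invariance (st χ) q c = q c
    stutter-invariance (¬ₚ φ) q c = mk⇔ (λ n h → n (from ih h)) (λ n h → n (to ih h))
      where ih = stutter-invariance φ q c
    stutter-invariance (φ ∧ₚ ψ) (q , r) c =
      mk⇔ (λ (a , b) → to ih₁ a , to ih₂ b) (λ (a , b) → from ih₁ a , from ih₂ b)
      where ih₁ = stutter-invariance φ q c
            ih₂ = stutter-invariance ψ r c
    stutter-invariance (φ U ψ) (q , r) c = mk⇔
      (until-transfer {C = C} fwd (λ c → to (stutter-invariance φ q c)) (λ c → to (stutter-invariance ψ r c)) c)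
      (until-transfer {C = flip C} bwd (λ c → from (stutter-invariance φ q c)) (λ c → from (stutter-invariance ψ r c)) c)

  holds-cong : {L L' : ℕ → StateF AP → Set} → ∀ φ → Leaves (λ χ → ∀ i → L i χ ⇔ L' i χ) φ →
               ∀ i → Holds L φ i ⇔ Holds L' φ i
  holds-cong {L} {L'} φ q i = stutter-invariance {C = _≡_}
    (λ { refl → wait refl (done refl) }) (λ { refl → wait refl (done refl) }) φ
    (leaves-map φ (λ { _ q refl → q _ }) q) refl

until-intro : ∀ {A B : ℕ → Set} n j → B (n + j) → (∀ i → i < j → A (n + i)) → Until A B n
until-intro {B = B} n zero b a = here (subst B (+-identityʳ n) b)
until-intro {A} {B} n (suc j) b a =
  there (subst A (+-identityʳ n) (a 0 (s≤s z≤n)))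
        (until-intro (suc n) j (subst B (+-suc n j) b) λ i lt → subst A (+-suc n i) (a (suc i) (s≤s lt)))

until-elim : ∀ {A B : ℕ → Set} {n} → Until A B n → ∃[ j ] (B (n + j) × (∀ i → i < j → A (n + i)))
until-elim {B = B} {n} (here b) = 0 , subst B (sym (+-identityʳ n)) b , λ _ ()
until-elim {A} {B} {n} (there a u) with until-elim u
... | j , b , as = suc j , subst B (sym (+-suc n j)) b ,
  λ { zero _ → subst A (sym (+-identityʳ n)) a ; (suc i) (s≤s lt) → subst A (sym (+-suc n i)) (as i lt) }

-- Paths of an LTS as sequences of states.

module _ {AP : Set} (M : LTS AP) where
  open LTS M

  Along : (ℕ → State) → ℕ → StateF AP → Set
  Along f i χ = _⊨ₛ_ M (f i) χ

  -- Stated for any path that agrees pointwise with a shift of `f`, because a suffix of such a path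
  -- is again a shift only up to associativity of addition.
  ⊨⇔holds : ∀ (f : ℕ → State) σ n → (∀ i → Path.at σ i ≡ f (n + i)) →
            ∀ φ → (_⊨ₚ_ M σ φ) ⇔ Holds (Along f) φ n
  ⊨⇔holds f σ n eq (st χ) = mk⇔ (subst (λ s → _⊨ₛ_ M s χ) e) (subst (λ s → _⊨ₛ_ M s χ) (sym e))
    where e = trans (eq 0) (cong f (+-identityʳ n))
  ⊨⇔holds f σ n eq (¬ₚ φ) = mk⇔ (λ k h → k (from ih h)) (λ k h → k (to ih h))
    where ih = ⊨⇔holds f σ n eq φ
  ⊨⇔holds f σ n eq (φ ∧ₚ ψ) =
    mk⇔ (λ (a , b) → to ih₁ a , to ih₂ b) (λ (a , b) → from ih₁ a , from ih₂ b)
    where ih₁ = ⊨⇔holds f σ n eq φ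
          ih₂ = ⊨⇔holds f σ n eq ψ
  ⊨⇔holds f σ n eq (φ U ψ) = mk⇔
    (λ (j , b , a) → until-intro n j (to (ih ψ j) b) (λ i lt → to (ih φ i) (a i lt)))
    (λ u → let j , b , a = until-elim u in j , from (ih ψ j) b , λ i lt → from (ih φ i) (a i lt))
    where
    ih : ∀ χ j → _⊨ₚ_ M (suffix M σ j) χ ⇔ Holds (Along f) χ (n + j)
    ih χ j = ⊨⇔holds f (suffix M σ j) (n + j)
               (λ i → trans (eq (j + i)) (cong f (sym (+-assoc n j i)))) χ

  -- A sequence that stutters between infinitely many genuine steps is collapsed to a path.
  module Collapse (f : ℕ → State) (move : ∀ i → (f i ≡ f (suc i)) ⊎ Step (f i) (f (suc i)))
                  (progress : ∀ i → Eventually (λ j → Step (f j) (f (suc j))) i) where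

    data Next (i : ℕ) : Set where
      stop : Step (f i) (f (suc i)) → Next i
      skip : f i ≡ f (suc i) → Next (suc i) → Next i

    next : ∀ i → Next i
    next i = go (progress i)
      where
      go : ∀ {i} → Eventually (λ j → Step (f j) (f (suc j))) i → Next i
      go (here s) = stop s
      go {i} (there tt u) with move i
      ... | inj₁ eq = skip eq (go u)
      ... | inj₂ s  = stop s

    time : ∀ {i} → Next i → ℕ
    time {i} (stop _)   = i
    time     (skip _ n) = time n

    time-step : ∀ {i} (n : Next i) → Step (f (time n)) (f (suc (time n)))
    time-step (stop s)   = s
    time-step (skip _ n) = time-step n

    time-const : ∀ {i} (n : Next i) → f i ≡ f (time n)
    time-const (stop _)    = refl
    time-const (skip eq n) = trans eq (time-const n)

    stop-time : ℕ → ℕ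
    stop-time zero    = time (next 0)
    stop-time (suc m) = time (next (suc (stop-time m)))

    stop-time-step : ∀ m → Step (f (stop-time m)) (f (suc (stop-time m)))
    stop-time-step zero    = time-step (next 0)
    stop-time-step (suc m) = time-step (next (suc (stop-time m)))

    path : Path M
    path = mkPath (λ m → f (stop-time m))
                  (λ m → subst (Step _) (time-const (next (suc (stop-time m)))) (stop-time-step m))

    -- Position `i` lies in the stuttering block that ends with the genuine step number `m`. The
    -- derivation is kept, since a self-loop can be read both as a stutter and as a step.
    Same : ℕ → ℕ → Set
    Same i m = Σ (Next i) λ n → time n ≡ stop-time m

    restart : ∀ {i m} → i ≡ stop-time m → Same (suc i) (suc m)
    restart {i} eq = next (suc i) , cong (λ j → time (next (suc j))) eq

    fwd : ∀ {i m} → Same i m → Leads Same i m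
    fwd {m = m} (stop s , eq)   = wait (stop s , eq) (done (restart {m = m} eq))
    fwd         (skip _ n , eq) = done (n , eq)

    bwd : ∀ {i m} → Same i m → Leads (flip Same) m i
    bwd (n , eq) = go n eq
      where
      go : ∀ {i m} (n : Next i) → time n ≡ stop-time m → Leads (flip Same) m i
      go {m = m} (stop s)   eq = wait (stop s , eq) (done (restart {m = m} eq))
      go         (skip e n) eq = wait (skip e n , eq) (go n eq)

    holds⇒E : ∀ φ → Holds (Along f) φ 0 → _⊨ₛ_ M (f 0) (E φ)
    holds⇒E φ h = path , sym (time-const (next 0)) ,
      from (⊨⇔holds (Path.at path) path 0 (λ _ → refl) φ)
        (to (stutter-invariance {C = Same} fwd bwd φ (leaves same φ) (next 0 , refl)) h)
      where
      same : ∀ χ {i m} → Same i m → Along f i χ ⇔ Along (Path.at path) m χ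
      same χ (n , eq) = mk⇔ (subst (λ s → _⊨ₛ_ M s χ) e) (subst (λ s → _⊨ₛ_ M s χ) (sym e))
        where e = trans (time-const n) (cong f eq)

-- Decidability of reachability: Via zs x y says that y is reachable from x by a nonempty walk whose
-- intermediate vertices lie in zs (Warshall's recursion).

module _ {A : Set} {R : A → A → Set} (R? : ∀ x y → Dec (R x y)) where

  Via : List A → A → A → Set
  Via []       x y = R x y
  Via (z ∷ zs) x y = Via zs x y ⊎ (Via zs x z × Via zs z y)

  via? : ∀ zs x y → Dec (Via zs x y)
  via? []       x y = R? x y
  via? (z ∷ zs) x y = via? zs x y ⊎-dec (via? zs x z ×-dec via? zs z y)

  via⇒⁺ : ∀ zs {x y} → Via zs x y → Star⁺ R x y
  via⇒⁺ []       r              = r ◂ ε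
  via⇒⁺ (z ∷ zs) (inj₁ v)       = via⇒⁺ zs v
  via⇒⁺ (z ∷ zs) (inj₂ (v , w)) = via⇒⁺ zs v ⁺◅◅ ⁺⇒* (via⇒⁺ zs w)

  via-edge : ∀ zs {x y} → R x y → Via zs x y
  via-edge []       r = r
  via-edge (_ ∷ zs) r = inj₁ (via-edge zs r)

  -- If `m` is the pivot, the walks are cut at its first and last visit. If both walks pass through
  -- another pivot, the part between its two visits, which contains `m`, is dropped.
  via-trans : ∀ {zs m x y} → m ∈ zs → Via zs x m → Via zs m y → Via zs x y
  via-trans {_ ∷ zs} (here refl) p q = inj₂ (first zs p , second zs q)
    where
    first : ∀ zs {x z} → Via (z ∷ zs) x z → Via zs x z
    first _ (inj₁ v)       = v
    first _ (inj₂ (v , _)) = v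
    second : ∀ zs {x z} → Via (z ∷ zs) z x → Via zs z x
    second _ (inj₁ v)       = v
    second _ (inj₂ (_ , v)) = v
  via-trans {_ ∷ zs} (there m) (inj₁ p)       (inj₁ q)       = inj₁ (via-trans {zs} m p q)
  via-trans {_ ∷ zs} (there m) (inj₁ p)       (inj₂ (q , r)) = inj₂ (via-trans {zs} m p q , r)
  via-trans {_ ∷ zs} (there m) (inj₂ (p , q)) (inj₁ r)       = inj₂ (p , via-trans {zs} m q r)
  via-trans {_ ∷ zs} (there m) (inj₂ (p , _)) (inj₂ (_ , r)) = inj₂ (p , r)

  ⁺⇒via : (fin : Finite A) → ∀ {x y z} → R x y → Star R y z → Via (Finite.elems fin) x z
  ⁺⇒via fin r ε        = via-edge (Finite.elems fin) r
  ⁺⇒via fin r (s ◅ ss) =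
    via-trans {Finite.elems fin} (Finite.complete fin _) (via-edge (Finite.elems fin) r) (⁺⇒via fin s ss)

  reachable? : Finite A → ∀ x y → Dec (Star⁺ R x y)
  reachable? fin x y = 
    map′ (via⇒⁺ (Finite.elems fin)) (λ (r ◂ rs) → ⁺⇒via fin r rs) (via? (Finite.elems fin) x y)

bounded : {A : Set} → Finite A → (N : A → ℕ) → ∃[ m ] ∀ a → N a ≤ m
bounded {A} fin N = let m , ps = go (Finite.elems fin) in m , λ a → All.lookup ps (Finite.complete fin a)
  where
  go : ∀ xs → ∃[ m ] All.All (λ a → N a ≤ m) xs
  go []       = 0 , []
  go (x ∷ xs) = let m , ps = go xs in
    N x ⊔ m , m≤m⊔n (N x) m ∷ All.map (λ le → ≤-trans le (m≤n⊔m (N x) m)) ps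

-- R i c stands for "c occurs at time i"; the sequence itself need not be given as a function.
recurrent : {A : Set} → Finite A → (R : ℕ → A → Set) → (∀ i → ¬ ¬ ∃ (R i)) →
            ¬ ¬ (∃[ c ] ∀ n → ¬ ¬ (∃[ i ] (n ≤ i × R i c)))
recurrent fin R total none =
  ¬¬-∀ fin {λ c → ∃[ n ] ∀ i → n ≤ i → ¬ R i c}
    (λ c k → none (c , λ n k' → k (n , λ i le r → k' (i , le , r))))
    (λ N → let m , bound = bounded fin (proj₁ ∘ N) in
      total m (λ (c , r) → proj₂ (N c) m (bound c) r))

AtSource : {A B : Set} → (A → B → Set) → A × B → A × B → Set
AtSource F (s , a) _ = F s a

-- A tableau for E φ over a finite LTS: states are annotated with the truth values of the
-- U-subformulas of φ, and E φ holds iff there is a reachable cycle on which no U-subformula is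
-- promised forever without being fulfilled.

module Tableau {AP : Set} (M : LTS AP) where
  open LTS M

  private
    _⊨_ : State → StateF AP → Set
    _⊨_ = _⊨ₛ_ M

  Asg : PathF AP → Set
  Asg (st _)   = ⊤
  Asg (¬ₚ φ)   = Asg φ
  Asg (φ ∧ₚ ψ) = Asg φ × Asg ψ
  Asg (φ U ψ)  = Bool × (Asg φ × Asg ψ)

  Val : ∀ φ → State → Asg φ → Set
  Val (st χ)   s _       = s ⊨ χ
  Val (¬ₚ φ)   s a       = ¬ Val φ s a
  Val (φ ∧ₚ ψ) s (a , b) = Val φ s a × Val ψ s b
  Val (_ U _)  s (u , _) = u ≡ true

  Consistent : ∀ φ → State → Asg φ → Set
  Consistent (st _)   s _       = ⊤
  Consistent (¬ₚ φ)   s a       = Consistent φ s a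
  Consistent (φ ∧ₚ ψ) s (a , b) = Consistent φ s a × Consistent ψ s b
  Consistent (φ U ψ)  s (u , a , b) =
    ((Val ψ s b → u ≡ true) × (u ≡ true → Val ψ s b ⊎ Val φ s a)) × Consistent φ s a × Consistent ψ s b

  -- With `Consistent`, this is the expansion law of until, split into a part about one node and a
  -- part about two successive nodes. In this form it is reflexive (`linked-refl`), so that a run
  -- may stutter without violating the tableau.
  Linked : ∀ φ → State → Asg φ → Asg φ → Set
  Linked (st _)   s _       _         = ⊤
  Linked (¬ₚ φ)   s a       a'        = Linked φ s a a'
  Linked (φ ∧ₚ ψ) s (a , b) (a' , b') = Linked φ s a a' × Linked ψ s b b'
  Linked (φ U ψ)  s (u , a , b) (u' , a' , b') =
    ((u ≡ true → Val ψ s b ⊎ u' ≡ true) × (Val φ s a → u' ≡ true → u ≡ true)) × Linked φ s a a' × Linked ψ s b b'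

  linked-refl : ∀ φ s a → Linked φ s a a
  linked-refl (st _)   s _           = tt
  linked-refl (¬ₚ φ)   s a           = linked-refl φ s a
  linked-refl (φ ∧ₚ ψ) s (a , b)     = linked-refl φ s a , linked-refl ψ s b
  linked-refl (φ U ψ)  s (u , a , b) = (inj₂ , λ _ eq → eq) , linked-refl φ s a , linked-refl ψ s b

  -- Q is required of every fairness condition of φ: for each subformula φ U ψ, that the bit is off or ψ holds.
  FairAll : ∀ φ → ((State → Asg φ → Set) → Set) → Set
  FairAll (st _)   Q = ⊤
  FairAll (¬ₚ φ)   Q = FairAll φ Q
  FairAll (φ ∧ₚ ψ) Q = FairAll φ (λ F → Q λ s → F s ∘ proj₁) × FairAll ψ (λ F → Q λ s → F s ∘ proj₂)
  FairAll (φ U ψ)  Q =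
    Q (λ s (u , a , b) → u ≡ false ⊎ Val ψ s b) ×
    FairAll φ (λ F → Q λ s → F s ∘ proj₁ ∘ proj₂) × FairAll ψ (λ F → Q λ s → F s ∘ proj₂ ∘ proj₂)

  fair-map : ∀ φ {Q Q'} → (∀ F → Q F → Q' F) → FairAll φ Q → FairAll φ Q'
  fair-map (st _)   h _           = tt
  fair-map (¬ₚ φ)   h p           = fair-map φ h p
  fair-map (φ ∧ₚ ψ) h (p , q)     = fair-map φ (λ F → h _) p , fair-map ψ (λ F → h _) q
  fair-map (φ U ψ)  h (r , p , q) = h _ r , fair-map φ (λ F → h _) p , fair-map ψ (λ F → h _) q

  fair-¬¬ : ∀ φ {Q} → FairAll φ (λ F → ¬ ¬ Q F) → ¬ ¬ FairAll φ Q
  fair-¬¬ (st _)   _           = return tt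
  fair-¬¬ (¬ₚ φ)   p           = fair-¬¬ φ p
  fair-¬¬ (φ ∧ₚ ψ) (p , q)     = fair-¬¬ φ p >>= λ p' → fair-¬¬ ψ q >>= λ q' → return (p' , q')
  fair-¬¬ (φ U ψ)  (r , p , q) =
    r >>= λ r' → fair-¬¬ φ p >>= λ p' → fair-¬¬ ψ q >>= λ q' → return (r' , p' , q')

  LeafDec : PathF AP → Set
  LeafDec = Leaves (λ χ → ∀ s → Dec (s ⊨ χ))

  val? : ∀ φ → LeafDec φ → ∀ s a → Dec (Val φ s a)
  val? (st χ)   d       s _       = d s
  val? (¬ₚ φ)   d       s a       = ¬? (val? φ d s a)
  val? (φ ∧ₚ ψ) (d , e) s (a , b) = val? φ d s a ×-dec val? ψ e s b
  val? (_ U _)  _       s (u , _) = u Bool.≟ true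

  consistent? : ∀ φ → LeafDec φ → ∀ s a → Dec (Consistent φ s a)
  consistent? (st χ)   d       s _       = yes tt
  consistent? (¬ₚ φ)   d       s a       = consistent? φ d s a
  consistent? (φ ∧ₚ ψ) (d , e) s (a , b) = consistent? φ d s a ×-dec consistent? ψ e s b
  consistent? (φ U ψ)  (d , e) s (u , a , b) =
    ((val? ψ e s b →-dec (u Bool.≟ true)) ×-dec ((u Bool.≟ true) →-dec (val? ψ e s b ⊎-dec val? φ d s a)))
    ×-dec (consistent? φ d s a ×-dec consistent? ψ e s b)

  linked? : ∀ φ → LeafDec φ → ∀ s a a' → Dec (Linked φ s a a')
  linked? (st χ)   d       s _       _         = yes tt
  linked? (¬ₚ φ)   d       s a       a'        = linked? φ d s a a'
  linked? (φ ∧ₚ ψ) (d , e) s (a , b) (a' , b') = linked? φ d s a a' ×-dec linked? ψ e s b b'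
  linked? (φ U ψ)  (d , e) s (u , a , b) (u' , a' , b') =
    (((u Bool.≟ true) →-dec (val? ψ e s b ⊎-dec (u' Bool.≟ true)))
      ×-dec (val? φ d s a →-dec ((u' Bool.≟ true) →-dec (u Bool.≟ true))))
    ×-dec (linked? φ d s a a' ×-dec linked? ψ e s b b')

  fair? : ∀ φ {Q} → LeafDec φ → (∀ F → (∀ s a → Dec (F s a)) → Dec (Q F)) → Dec (FairAll φ Q)
  fair? (st _)   d       q = yes tt
  fair? (¬ₚ φ)   d       q = fair? φ d q
  fair? (φ ∧ₚ ψ) (d , e) q =
    fair? φ d (λ F F? → q _ λ s a → F? s (proj₁ a)) ×-dec fair? ψ e (λ F F? → q _ λ s a → F? s (proj₂ a))
  fair? (φ U ψ)  (d , e) q =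
    q _ (λ s (u , a , b) → (u Bool.≟ false) ⊎-dec val? ψ e s b) ×-dec
    (fair? φ d (λ F F? → q _ λ s a → F? s (proj₁ (proj₂ a))) ×-dec
     fair? ψ e (λ F F? → q _ λ s a → F? s (proj₂ (proj₂ a))))

  asg-finite : ∀ φ → Finite (Asg φ)
  asg-finite (st _)   = finite-⊤
  asg-finite (¬ₚ φ)   = asg-finite φ
  asg-finite (φ ∧ₚ ψ) = finite-× (asg-finite φ) (asg-finite ψ)
  asg-finite (φ U ψ)  = finite-× finite-Bool (finite-× (asg-finite φ) (asg-finite ψ))

  Node : PathF AP → Set
  Node φ = State × Asg φ

  TStep : ∀ φ → Node φ → Node φ → Set
  TStep φ (s , a) (t , b) = Step s t × Consistent φ s a × Linked φ s a b

  -- The local conditions propagate a promised until from node to node as long as `ψ` fails.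
  -- Fairness bounds this: eventually the bit is off, which is then impossible, or `ψ` holds.
  truth : ∀ φ (s : ℕ → State) (a : ℕ → Asg φ) → (∀ i → Consistent φ (s i) (a i)) →
          (∀ i → Linked φ (s i) (a i) (a (suc i))) →
          FairAll φ (λ F → ∀ i → Eventually (λ j → F (s j) (a j)) i) →
          ∀ i → Val φ (s i) (a i) ⇔ Holds (Along M s) φ i
  truth (st χ) s a con lnk fair i = mk⇔ id id
  truth (¬ₚ φ) s a con lnk fair i = mk⇔ (λ n h → n (from ih h)) (λ n h → n (to ih h))
    where ih = truth φ s a con lnk fair i
  truth (φ ∧ₚ ψ) s a con lnk (f , g) i =
    mk⇔ (λ (v , w) → to ih₁ v , to ih₂ w) (λ (v , w) → from ih₁ v , from ih₂ w)
    where
    ih₁ = truth φ s (proj₁ ∘ a) (proj₁ ∘ con) (proj₁ ∘ lnk) f i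
    ih₂ = truth ψ s (proj₂ ∘ a) (proj₂ ∘ con) (proj₂ ∘ lnk) g i
  truth (φ U ψ) s a con lnk (e , f , g) i = mk⇔ (promise (e i)) fulfil
    where
    ih₁ = truth φ s (proj₁ ∘ proj₂ ∘ a) (proj₁ ∘ proj₂ ∘ con) (proj₁ ∘ proj₂ ∘ lnk) f
    ih₂ = truth ψ s (proj₂ ∘ proj₂ ∘ a) (proj₂ ∘ proj₂ ∘ con) (proj₂ ∘ proj₂ ∘ lnk) g

    promise : ∀ {i} → Eventually (λ j → proj₁ (a j) ≡ false ⊎ Val ψ (s j) (proj₂ (proj₂ (a j)))) i →
              proj₁ (a i) ≡ true → Holds (Along M s) (φ U ψ) i
    promise     (here (inj₁ eq)) u = contradiction (trans (sym u) eq) (λ ())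
    promise {i} (here (inj₂ v))  u = here (to (ih₂ i) v)
    promise {i} (there tt ev)    u with proj₂ (proj₁ (con i)) u
    ... | inj₁ v = here (to (ih₂ i) v)
    ... | inj₂ v with proj₁ (proj₁ (lnk i)) u
    ...   | inj₁ w  = here (to (ih₂ i) w)
    ...   | inj₂ u' = there (to (ih₁ i) v) (promise ev u')

    fulfil : ∀ {i} → Holds (Along M s) (φ U ψ) i → proj₁ (a i) ≡ true
    fulfil {i} (here h)    = proj₁ (proj₁ (con i)) (from (ih₂ i) h)
    fulfil {i} (there h u) = proj₂ (proj₁ (lnk i)) (from (ih₁ i) h) (fulfil u)

  record Lasso (φ : PathF AP) (s : State) : Set where
    field
      asg  : Asg φ
      node : Node φ
      val  : Val φ s asg
      stem : Star (TStep φ) (s , asg) node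
      loop : Star⁺ (TStep φ) node node
      fair : FairAll φ (λ F → AnyEdge (AtSource F) (⁺⇒* loop))

  -- The decidable counterpart of `Lasso`: it speaks of reachability only, and every fairness
  -- condition has its own witness in the strongly connected component of `c`.
  Good : (φ : PathF AP) → State → Set
  Good φ s = ∃[ a ] ∃[ c ] (Val φ s a × Star⁺ (TStep φ) (s , a) c × Star⁺ (TStep φ) c c ×
    FairAll φ (λ F → ∃[ y ] (F (proj₁ y) (proj₂ y) × Star⁺ (TStep φ) c y × Star⁺ (TStep φ) y c)))

  good⇒lasso : ∀ {φ s} → Good φ s → Lasso φ s
  good⇒lasso {φ} (a , c , v , stem , (r ◂ loop) , fair) = record
    -- The cycle through `c` comes first, so that the loop is nonempty even if there are no fairness
    -- conditions to visit.
    { asg = a ; node = c ; val = v ; stem = ⁺⇒* stem ; loop = r ◂ (loop ◅◅ w)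
    ; fair = fair-map φ (λ F → any-++ʳ (r ◅ loop)) hits }
    where
    -- Concatenates the round trips from `c` through the witnesses; `f` extracts the assignment of
    -- the subformula `ψ` from that of `φ`.
    tour : ∀ ψ (f : Asg φ → Asg ψ) →
           FairAll ψ (λ F → ∃[ y ] (F (proj₁ y) (f (proj₂ y)) × Star⁺ (TStep φ) c y × Star⁺ (TStep φ) y c)) →
           Σ (Star (TStep φ) c c) λ w → FairAll ψ (λ F → AnyEdge (AtSource (λ s → F s ∘ f)) w)
    both : ∀ ψ₁ ψ₂ (f₁ : Asg φ → Asg ψ₁) (f₂ : Asg φ → Asg ψ₂) →
           FairAll ψ₁ (λ F → ∃[ y ] (F (proj₁ y) (f₁ (proj₂ y)) × Star⁺ (TStep φ) c y × Star⁺ (TStep φ) y c)) →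
           FairAll ψ₂ (λ F → ∃[ y ] (F (proj₁ y) (f₂ (proj₂ y)) × Star⁺ (TStep φ) c y × Star⁺ (TStep φ) y c)) →
           Σ (Star (TStep φ) c c) λ w → FairAll ψ₁ (λ F → AnyEdge (AtSource (λ s → F s ∘ f₁)) w) ×
                                        FairAll ψ₂ (λ F → AnyEdge (AtSource (λ s → F s ∘ f₂)) w)
    both ψ₁ ψ₂ f₁ f₂ p q with tour ψ₁ f₁ p | tour ψ₂ f₂ q
    ... | w , h | w' , h' = w ◅◅ w' , fair-map ψ₁ (λ F → any-++ˡ w') h , fair-map ψ₂ (λ F → any-++ʳ w) h'

    tour (st _)     f _       = ε , tt
    tour (¬ₚ ψ)     f p       = tour ψ f p
    tour (ψ₁ ∧ₚ ψ₂) f (p , q) = both ψ₁ ψ₂ (proj₁ ∘ f) (proj₂ ∘ f) p q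
    tour (ψ₁ U ψ₂)  f ((y , h , out , r ◂ back) , p , q)
      with both ψ₁ ψ₂ (proj₁ ∘ proj₂ ∘ f) (proj₂ ∘ proj₂ ∘ f) p q
    ... | w , h₁ , h₂ = ⁺⇒* out ◅◅ ((r ◅ back) ◅◅ w) , any-++ʳ (⁺⇒* out) (here h) ,
      fair-map ψ₁ (λ F → any-++ʳ (⁺⇒* out) ∘ any-++ʳ (r ◅ back)) h₁ ,
      fair-map ψ₂ (λ F → any-++ʳ (⁺⇒* out) ∘ any-++ʳ (r ◅ back)) h₂

    whole = tour φ id fair
    w     = proj₁ whole
    hits  = proj₂ whole

  lasso⇒E : ∀ {φ s} → Lasso φ s → s ⊨ E φ
  lasso⇒E {φ} {s} l =
    mkPath states (λ i → proj₁ (edge (run c₀ i))) , refl ,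
    from (⊨⇔holds M states _ 0 (λ _ → refl) φ)
      (to (truth φ states (λ i → proj₂ (pos (run c₀ i)))
             (λ i → proj₁ (proj₂ (edge (run c₀ i)))) (λ i → proj₂ (proj₂ (edge (run c₀ i))))
             (fair-map φ (λ F h → visits c₀ (λ _ → h)) fair) 0) val)
    where
    open Lasso l
    open Unfold {K = ⊤} (λ _ → node) id (λ _ → loop)
    c₀ : Config
    c₀ = config tt _ stem
    states : ℕ → State
    states i = proj₁ (pos (run c₀ i))

  module _ (φ : PathF AP) (fin : Finite State) (π : Path M) where

    private
      f : ℕ → State
      f = Path.at π

    -- Truth along an arbitrary path is not decided, so the correct assignment at a position is
    -- given by a relation, and it exists only up to double negation.
    Right : ∀ φ → ℕ → Asg φ → Set
    Right (st _)   i _           = ⊤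
    Right (¬ₚ φ)   i a           = Right φ i a
    Right (φ ∧ₚ ψ) i (a , b)     = Right φ i a × Right ψ i b
    Right (φ U ψ)  i (u , a , b) = (u ≡ true ⇔ Holds (Along M f) (φ U ψ) i) × Right φ i a × Right ψ i b

    right-exists : ∀ φ i → ¬ ¬ ∃ (Right φ i)
    right-exists (st _)   i = return (tt , tt)
    right-exists (¬ₚ φ)   i = right-exists φ i
    right-exists (φ ∧ₚ ψ) i = right-exists φ i >>= λ (a , r) → right-exists ψ i >>= λ (b , q) →
                              return ((a , b) , r , q)
    right-exists (φ U ψ)  i =
      right-exists φ i >>= λ (a , r) → right-exists ψ i >>= λ (b , q) → ¬¬-excluded-middle >>= λ
        { (yes h) → return ((true , a , b) , mk⇔ (λ _ → h) (λ _ → refl) , r , q)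
        ; (no ¬h) → return ((false , a , b) , mk⇔ (λ ()) (λ h → contradiction h ¬h) , r , q) }

    right-val : ∀ φ {i a} → Right φ i a → Val φ (f i) a ⇔ Holds (Along M f) φ i
    right-val (st _)   _       = mk⇔ id id
    right-val (¬ₚ φ)   r       = mk⇔ (λ n h → n (from (right-val φ r) h)) (λ n h → n (to (right-val φ r) h))
    right-val (φ ∧ₚ ψ) (r , q) = mk⇔ (λ (v , w) → to (right-val φ r) v , to (right-val ψ q) w)
                                     (λ (v , w) → from (right-val φ r) v , from (right-val ψ q) w)
    right-val (φ U ψ)  (e , _) = e

    right-consistent : ∀ φ {i a} → Right φ i a → Consistent φ (f i) a
    right-consistent (st _)   _           = tt
    right-consistent (¬ₚ φ)   r           = right-consistent φ r
    right-consistent (φ ∧ₚ ψ) (r , q)     = right-consistent φ r , right-consistent ψ q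
    right-consistent (φ U ψ)  {i} {_ , a , b} (e , r , q) =
      ((λ v → from e (here (to (right-val ψ q) v))) , λ u → now (to e u)) ,
      right-consistent φ r , right-consistent ψ q
      where
      now : Holds (Along M f) (φ U ψ) i → Val ψ (f i) b ⊎ Val φ (f i) a
      now (here h)    = inj₁ (from (right-val ψ q) h)
      now (there h _) = inj₂ (from (right-val φ r) h)

    right-linked : ∀ φ {i a b} → Right φ i a → Right φ (suc i) b → Linked φ (f i) a b
    right-linked (st _)   _       _         = tt
    right-linked (¬ₚ φ)   r       r'        = right-linked φ r r'
    right-linked (φ ∧ₚ ψ) (r , q) (r' , q') = right-linked φ r r' , right-linked ψ q q'
    right-linked (φ U ψ)  {i} {_ , a , b} {u' , _} (e , r , q) (e' , r' , q') =
      ((λ u → later (to e u)) , λ v u' → from e (there (to (right-val φ r) v) (to e' u'))) ,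
      right-linked φ r r' , right-linked ψ q q'
      where
      later : Holds (Along M f) (φ U ψ) i → Val ψ (f i) b ⊎ u' ≡ true
      later (here h)    = inj₁ (from (right-val ψ q) h)
      later (there _ h) = inj₂ (from e' h)

    until-later : ∀ {A B : ℕ → Set} {i} → Until A B i → ∃[ j ] (i ≤ j × B j)
    until-later (here b)    = _ , ≤-refl , b
    until-later (there _ u) = let j , le , b = until-later u in j , ≤-trans (n≤1+n _) le , b

    right-fair : ∀ φ → FairAll φ λ F → ∀ i → ¬ ¬ (∃[ j ] (i ≤ j × (∀ a → Right φ j a → F (f j) a)))
    right-fair (st _)   = tt
    right-fair (¬ₚ φ)   = right-fair φ
    right-fair (φ ∧ₚ ψ) =
      fair-map φ (λ F h i → h i >>= λ (j , le , g) → return (j , le , λ a r → g _ (proj₁ r))) (right-fair φ) ,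
      fair-map ψ (λ F h i → h i >>= λ (j , le , g) → return (j , le , λ a r → g _ (proj₂ r))) (right-fair ψ)
    right-fair (φ U ψ) = here-fair ,
      fair-map φ (λ F h i → h i >>= λ (j , le , g) → return (j , le , λ a r → g _ (proj₁ (proj₂ r)))) (right-fair φ) ,
      fair-map ψ (λ F h i → h i >>= λ (j , le , g) → return (j , le , λ a r → g _ (proj₂ (proj₂ r)))) (right-fair ψ)
      where
      here-fair : ∀ i → ¬ ¬ (∃[ j ] (i ≤ j × (∀ a → Right (φ U ψ) j a →
                    (proj₁ a ≡ false ⊎ Val ψ (f j) (proj₂ (proj₂ a))))))
      -- Either `ψ` holds at some position from `i` on, which then serves, or it never does; in that
      -- case the until fails at `i` and its bit is off there.
      here-fair i = ¬¬-excluded-middle {A = ∃[ j ] (i ≤ j × Holds (Along M f) ψ j)} >>= λ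
        { (yes (j , le , h)) → return (j , le , λ a r → inj₂ (from (right-val ψ (proj₂ (proj₂ r))) h))
        ; (no none) → return (i , ≤-refl ,
            λ { (false , _) r → inj₁ refl
              ; (true , _)  r → contradiction (until-later (to (proj₁ r) refl)) none }) }

    OnPath : ℕ → Node φ → Set
    OnPath i (s , a) = f i ≡ s × Right φ i a

    on-path : ∀ i → ¬ ¬ ∃ (OnPath i)
    on-path i = right-exists φ i >>= λ (a , r) → return ((f i , a) , refl , r)

    on-path-step : ∀ {i x y} → OnPath i x → OnPath (suc i) y → TStep φ x y
    on-path-step {i} (refl , r) (refl , r') = Path.step π i , right-consistent φ r , right-linked φ r r'

    on-path-walk : ∀ {i j x y} → OnPath i x → OnPath j y → suc i ≤′ j → ¬ ¬ Star⁺ (TStep φ) x y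
    on-path-walk p q ≤′-refl             = return (on-path-step p q ◂ ε)
    on-path-walk p q (≤′-step {n = j} le) =
      on-path j >>= λ (z , o) → on-path-walk p o le >>= λ w → return (w ⁺◅◅ (on-path-step o q ◅ ε))

    -- Some node recurs forever. Two of its occurrences bound the cycle, and each fairness witness
    -- is taken after one occurrence and before another. Starting from position 1 makes the stem
    -- nonempty.
    E⇒good : _⊨ₚ_ M π φ → ¬ ¬ Good φ (f 0)
    E⇒good h =
      recurrent (finite-× fin (asg-finite φ)) OnPath on-path >>= λ (c , often) →
      right-exists φ 0 >>= λ (a , r₀) →
      often 1 >>= λ (i , i≥1 , oᵢ) →
      often (suc i) >>= λ (i' , i'>i , oᵢ') →
      on-path-walk (refl , r₀) oᵢ (≤⇒≤′ i≥1) >>= λ stem →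
      on-path-walk oᵢ oᵢ' (≤⇒≤′ i'>i) >>= λ loop →
      fair-¬¬ φ (fair-map φ (λ F fair →
        fair (suc i) >>= λ (j , j>i , g) →
        on-path j >>= λ { (y , refl , r) →
        often (suc j) >>= λ (j' , j'>j , o) →
        on-path-walk oᵢ (refl , r) (≤⇒≤′ j>i) >>= λ out →
        on-path-walk (refl , r) o (≤⇒≤′ j'>j) >>= λ back →
        return (y , g _ r , out , back) }) (right-fair φ)) >>= λ fair →
      return (a , c , from (right-val φ r₀) (to (⊨⇔holds M f π 0 (λ _ → refl) φ) h) , stem , loop , fair)

  module _ (fin : Finite State) (step? : ∀ s t → Dec (Step s t)) where

    tstep? : ∀ φ → LeafDec φ → ∀ x y → Dec (TStep φ x y)
    tstep? φ d (s , a) (t , b) = step? s t ×-dec (consistent? φ d s a ×-dec linked? φ d s a b)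

    good? : ∀ φ → LeafDec φ → ∀ s → Dec (Good φ s)
    good? φ d s =
      ∃? (asg-finite φ) λ a → ∃? node-finite λ c →
        val? φ d s a ×-dec (reach? (s , a) c ×-dec (reach? c c ×-dec
        fair? φ d λ F F? → ∃? node-finite λ y → F? (proj₁ y) (proj₂ y) ×-dec (reach? c y ×-dec reach? y c)))
      where
      node-finite : Finite (Node φ)
      node-finite = finite-× fin (asg-finite φ)
      reach? : ∀ x y → Dec (Star⁺ (TStep φ) x y)
      reach? = reachable? (tstep? φ d) node-finite

    -- Spelled out instead of obtained from `leaves`, so that the mutual recursion with `_⊨?_` is
    -- structural.
    leafDec : ∀ φ → LeafDec φ
    _⊨?_ : ∀ s χ → Dec (s ⊨ χ)

    leafDec (st χ)   = λ s → s ⊨? χ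
    leafDec (¬ₚ φ)   = leafDec φ
    leafDec (φ ∧ₚ ψ) = leafDec φ , leafDec ψ
    leafDec (φ U ψ)  = leafDec φ , leafDec ψ

    s ⊨? tt       = yes tt
    s ⊨? atom p   = label s p Bool.≟ true
    s ⊨? (¬ₛ χ)   = ¬? (s ⊨? χ)
    s ⊨? (χ ∧ₛ ξ) = (s ⊨? χ) ×-dec (s ⊨? ξ)
    s ⊨? E φ with good? φ (leafDec φ) s
    ... | yes g = yes (lasso⇒E {φ} (good⇒lasso g))
    ... | no ¬g = no λ { (π , refl , h) → E⇒good φ fin π h ¬g }

-- Runs of a single process.

module Local {AP : Set} (P : ProcTemplate AP) where
  open ProcTemplate P

  -- The restriction on action sequences, in a form that is inherited by successors.
  Live : Fin nQ → Set
  Live q = ∀ (ρ : ℕ → Fin nQ) (α : ℕ → Act (suc mInt)) → ρ 0 ≡ q →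
           (∀ i → δ (ρ i) (α i) (ρ (suc i)) ≡ true) → ∀ n → ∃[ j ] (n ≤ j × isInt (α j) ≡ false)

  live-init : ∀ {q} → (q ≡ ιt) ⊎ (q ≡ ιn) → Live q
  live-init init ρ α refl steps n = [ visible refl , visible refl ]′ (runs-ok ρ α init steps)
    where
    visible : ∀ {a b} → isInt a ≡ false → InOmega a b α → ∃[ j ] (n ≤ j × isInt (α j) ≡ false)
    visible a-ext (t , mono , even , _) =
      -- An even index is chosen because its letter is known to be `a`; strict monotonicity of `t`
      -- gives `n + n ≤ t (n + n)`.
      t (n + n) , ≤-trans (m≤m+n n n) (diverges (n + n)) , trans (cong isInt (even n)) a-ext
      where
      diverges : ∀ j → j ≤ t j
      diverges zero    = z≤n
      diverges (suc j) = ≤-trans (s≤s (diverges j)) (mono j)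

  live-step : ∀ {q a q'} → δ q a q' ≡ true → Live q → Live q'
  live-step {q} {a} h live ρ α refl steps n =
    back (live (prepend q ρ) (prepend a α) refl (λ { zero → h ; (suc i) → steps i }) (suc n))
    where
    prepend : {A : Set} → A → (ℕ → A) → ℕ → A
    prepend x f zero    = x
    prepend x f (suc i) = f i

    back : ∃[ j ] (suc n ≤ j × isInt (prepend a α j) ≡ false) → ∃[ j ] (n ≤ j × isInt (α j) ≡ false)
    back (suc j , s≤s le , e) = j , le , e

  IntStep : Fin nQ → Fin nQ → Set
  IntStep q q' = ∃[ a ] δ q (int a) q' ≡ true

  -- Unfolded forever, the cycle would be a run from `q` without any visible action.
  no-internal-cycle : ∀ {q} → Live q → ¬ Star⁺ IntStep q q
  no-internal-cycle {q} live loop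
    with live (λ i → pos (run start i)) (λ i → int (proj₁ (edge (run start i)))) refl
              (λ i → proj₂ (edge (run start i))) 0
    where
    open Unfold {K = ⊤} (λ _ → q) id (λ _ → loop)
    start : Config
    start = config tt q ε
  ... | _ , _ , ()

  transfer : Bool → Act (suc mInt)
  transfer true  = snd
  transfer false = rcv

  -- Along a fixed choice of successors `Live` provides a visible action, and `search` stops at the
  -- first one. The internal steps before it preserve `tok`, which therefore decides whether it is a
  -- send or a receive.
  ready : ∀ {q} → Live q → ∃[ r ] (Star IntStep q r × ∃[ r' ] δ r (transfer (tok q)) r' ≡ true)
  ready {q} live =
    let j , _ , e = live (λ i → iter i q) (λ i → action (iter i q)) refl (λ i → proj₂ (proj₂ (total (iter i q)))) 0
    in search j q e
    where
    action : Fin nQ → Act (suc mInt)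
    action q = proj₁ (total q)
    succ : Fin nQ → Fin nQ
    succ q = proj₁ (proj₂ (total q))
    iter : ℕ → Fin nQ → Fin nQ
    iter zero    q = q
    iter (suc i) q = succ (iter i q)

    iter-suc : ∀ i q → iter (suc i) q ≡ iter i (succ q)
    iter-suc zero    q = refl
    iter-suc (suc i) q = cong succ (iter-suc i q)

    search : ∀ j q → isInt (action (iter j q)) ≡ false →
             ∃[ r ] (Star IntStep q r × ∃[ r' ] δ r (transfer (tok q)) r' ≡ true)
    search j q e with total q in eq
    ... | snd , q' , h = q , ε , q' , subst (λ b → δ q (transfer b) q' ≡ true) (sym (proj₁ (snd-TN q q' h))) h
    ... | rcv , q' , h = q , ε , q' , subst (λ b → δ q (transfer b) q' ≡ true) (sym (proj₁ (rcv-NT q q' h))) h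
    search zero    q e | int a , q' , h = contradiction (trans (sym e) (cong (isInt ∘ proj₁) eq)) (λ ())
    search (suc j) q e | int a , q' , h =
      let r , w , r' , h' = search j q' (subst (λ q → isInt (action q) ≡ false)
                              (trans (iter-suc j q) (cong (iter j) (cong (proj₁ ∘ proj₂) eq))) e)
      in r , (a , h) ◅ w , r' , subst (λ b → δ r (transfer b) r' ≡ true) (sym (int-same q a q' h)) h'

-- Global steps of the token-passing system.

module _ {AP : Set} (P : ProcTemplate AP) (G : Topology) where
  open ProcTemplate P
  open Topology G

  -- Global states are functions and are compared pointwise; this replaces extensionality when
  -- passing to vectors.
  gstep-resp : {s r s' r' : GState P G} → (∀ u → s u ≡ r u) → (∀ u → s' u ≡ r' u) →
               GStep P G s s' → GStep P G r r'
  gstep-resp {s} {r} {s'} {r'} e e' (internal v a h same) =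
    internal v a (subst₂ (λ q q' → δ q (int a) q' ≡ true) (e v) (e' v) h)
             (λ u ne → trans (sym (e' u)) (trans (same u ne) (e u)))
  gstep-resp {s} {r} {s'} {r'} e e' (pass v w edge hs hr same) =
    pass v w edge (subst₂ (λ q q' → δ q snd q' ≡ true) (e v) (e' v) hs)
         (subst₂ (λ q q' → δ q rcv q' ≡ true) (e w) (e' w) hr)
         (λ u ne ne' → trans (sym (e' u)) (trans (same u ne ne') (e u)))

  gstep? : ∀ s s' → Dec (GStep P G s s')
  gstep? s s' = map′
    [ (λ (v , a , h , same) → internal v a h same)
    , (λ (v , w , edge , hs , hr , same) → pass v w edge hs hr same) ]′
    (λ { (internal v a h same) → inj₁ (v , a , h , same)
       ; (pass v w edge hs hr same) → inj₂ (v , w , edge , hs , hr , same) })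
    ((any? λ v → any? λ a → (δ (s v) (int a) (s' v) Bool.≟ true) ×-dec
        all? λ u → ¬? (u ≟ v) →-dec (s' u ≟ s u))
     ⊎-dec
     (any? λ v → any? λ w → (Edge v w Bool.≟ true) ×-dec ((δ (s v) snd (s' v) Bool.≟ true) ×-dec
        ((δ (s w) rcv (s' w) Bool.≟ true) ×-dec
        all? λ u → ¬? (u ≟ v) →-dec (¬? (u ≟ w) →-dec (s' u ≟ s u))))))

-- The system P^G with its global states tabulated as vectors, which form a finite type.

module System {AP : Set} (P : ProcTemplate AP) (G : Topology) {k : ℕ} (g : Fin k → Fin (Topology.n G)) where
  open ProcTemplate P
  open Topology G
  open Local P

  VState : Set
  VState = Vec (Fin nQ) n

  VProj : LTS (AP × Fin k)
  VProj = record
    { State = VState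
    ; init  = tabulate (GInit P G)
    ; Step  = λ s s' → GStep P G (lookup s) (lookup s')
    ; label = λ s (p , i) → λP (lookup s (g i)) p
    }

  vstate-finite : Finite VState
  vstate-finite = finite-Vec (finite-Fin nQ) n

  vstep? : ∀ s s' → Dec (GStep P G (lookup s) (lookup s'))
  vstep? s s' = gstep? P G (lookup s) (lookup s')

  module _ where
    private
      M = Proj P G g

    vec-leaves : ∀ φ → Leaves (λ χ → ∀ {s x} → (∀ u → s u ≡ lookup x u) → _⊨ₛ_ M s χ ⇔ _⊨ₛ_ VProj x χ) φ
    vec-sat : ∀ χ {s x} → (∀ u → s u ≡ lookup x u) → _⊨ₛ_ M s χ ⇔ _⊨ₛ_ VProj x χ

    vec-leaves (st χ)   = vec-sat χ
    vec-leaves (¬ₚ φ)   = vec-leaves φ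
    vec-leaves (φ ∧ₚ ψ) = vec-leaves φ , vec-leaves ψ
    vec-leaves (φ U ψ)  = vec-leaves φ , vec-leaves ψ

    vec-sat tt       e = mk⇔ id id
    vec-sat (atom (p , i)) e = mk⇔ (subst (λ q → λP q p ≡ true) (e (g i)))
                                   (subst (λ q → λP q p ≡ true) (sym (e (g i))))
    vec-sat (¬ₛ χ)   e = mk⇔ (λ n h → n (from (vec-sat χ e) h)) (λ n h → n (to (vec-sat χ e) h))
    vec-sat (χ ∧ₛ ξ) e = mk⇔ (λ (a , b) → to (vec-sat χ e) a , to (vec-sat ξ e) b)
                             (λ (a , b) → from (vec-sat χ e) a , from (vec-sat ξ e) b)
    vec-sat (E φ) {s} {x} e = mk⇔
      (λ { (π , refl , h) →
        mkPath (λ i → tabulate (Path.at π i))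
               (λ i → gstep-resp P G (λ u → sym (lookup∘tabulate (Path.at π i) u))
                                     (λ u → sym (lookup∘tabulate (Path.at π (suc i)) u)) (Path.step π i)) ,
        trans (tabulate-cong e) (tabulate∘lookup x) ,
        from (⊨⇔holds VProj (λ i → tabulate (Path.at π i)) _ 0 (λ _ → refl) φ)
          (to (same φ (Path.at π) (λ i → tabulate (Path.at π i)) (λ i u → sym (lookup∘tabulate (Path.at π i) u)))
            (to (⊨⇔holds M (Path.at π) π 0 (λ _ → refl) φ) h)) })
      (λ { (π , refl , h) →
        mkPath (unvec π)
               (λ { zero    → gstep-resp P G (λ u → sym (e u)) (λ _ → refl) (Path.step π 0)
                  ; (suc i) → Path.step π (suc i) }) ,
        refl ,
        from (⊨⇔holds M (unvec π) _ 0 (λ _ → refl) φ)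
          (from (same φ (unvec π) (Path.at π) (λ { zero → e ; (suc i) u → refl }))
            (to (⊨⇔holds VProj (Path.at π) π 0 (λ _ → refl) φ) h)) })
      where
      -- The semantics of `E` asks for a path that starts in `s` itself, not in a pointwise equal
      -- function, so position 0 is set to `s`.
      unvec : Path VProj → ℕ → GState P G
      unvec π zero    = s
      unvec π (suc i) = lookup (Path.at π (suc i))

      same : ∀ ψ (f : ℕ → GState P G) (h : ℕ → VState) → (∀ i u → f i u ≡ lookup (h i) u) →
             Holds (Along M f) φ 0 ⇔ Holds (Along VProj h) φ 0
      same ψ f h eq = holds-cong φ (leaves-map φ (λ _ q i → q (eq i)) (vec-leaves φ)) 0

  vec-Sat : ∀ χ → Sat (Proj P G g) χ ⇔ Sat VProj χ
  vec-Sat χ = vec-sat χ (λ u → sym (lookup∘tabulate (GInit P G) u))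

  record Inv (s : VState) (v : Fin n) : Set where
    field
      token  : tok (lookup s v) ≡ true
      others : ∀ u → u ≢ v → tok (lookup s u) ≡ false
      live   : ∀ u → Live (lookup s u)

  open Inv public

  inv-unique : ∀ {s v w} → Inv s v → Inv s w → v ≡ w
  inv-unique {v = v} {w} i j with v ≟ w
  ... | yes eq = eq
  ... | no ne  = contradiction (trans (sym (token i)) (others j v ne)) (λ ())

  inv-init : Inv (tabulate (GInit P G)) x
  inv-init = record
    { token  = trans (cong tok (trans (lookup∘tabulate (GInit P G) x) at-x)) ιt-tok
    ; others = λ u ne → trans (cong tok (trans (lookup∘tabulate (GInit P G) u) (off-x u ne))) ιn-ntok
    ; live   = λ u → subst Live (sym (lookup∘tabulate (GInit P G) u)) (live-init (either u)) }
    where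
    at-x : GInit P G x ≡ ιt
    at-x with x ≟ x
    ... | yes _ = refl
    ... | no ne = contradiction refl ne
    off-x : ∀ u → u ≢ x → GInit P G u ≡ ιn
    off-x u ne with u ≟ x
    ... | yes eq = contradiction eq ne
    ... | no _   = refl
    either : ∀ u → (GInit P G u ≡ ιt) ⊎ (GInit P G u ≡ ιn)
    either u with u ≟ x
    ... | yes _ = inj₁ refl
    ... | no _  = inj₂ refl

  -- Global steps indexed by the token position before and after. Only a token holder can send, so
  -- under `Inv` every global step has this form.
  data TokStep (s s' : VState) (v : Fin n) : Fin n → Set where
    internal : ∀ u a → δ (lookup s u) (int a) (lookup s' u) ≡ true →
               (∀ w → w ≢ u → lookup s' w ≡ lookup s w) → TokStep s s' v v
    pass : ∀ {w} → Edge v w ≡ true → δ (lookup s v) snd (lookup s' v) ≡ true →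
           δ (lookup s w) rcv (lookup s' w) ≡ true →
           (∀ u → u ≢ v → u ≢ w → lookup s' u ≡ lookup s u) → TokStep s s' v w

  tokstep⇒gstep : ∀ {s s' v w} → TokStep s s' v w → GStep P G (lookup s) (lookup s')
  tokstep⇒gstep (internal u a h same)   = internal u a h same
  tokstep⇒gstep (pass edge hs hr same) = pass _ _ edge hs hr same

  tokstep-inv : ∀ {s s' v w} → TokStep s s' v w → Inv s v → Inv s' w
  tokstep-inv {s} {s'} {v} (internal u a h same) inv = record
    { token  = trans (sym (tok-same v)) (token inv)
    ; others = λ w ne → trans (sym (tok-same w)) (others inv w ne)
    ; live   = λ w → live' w }
    where
    tok-same : ∀ w → tok (lookup s w) ≡ tok (lookup s' w)
    tok-same w with w ≟ u
    ... | yes refl = int-same _ a _ h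
    ... | no ne    = cong tok (sym (same w ne))
    live' : ∀ w → Live (lookup s' w)
    live' w with w ≟ u
    ... | yes refl = live-step h (live inv u)
    ... | no ne    = subst Live (sym (same w ne)) (live inv w)
  tokstep-inv {s} {s'} {v} {w} (pass edge hs hr same) inv = record
    { token  = proj₂ (rcv-NT _ _ hr)
    ; others = others'
    ; live   = live' }
    where
    others' : ∀ u → u ≢ w → tok (lookup s' u) ≡ false
    others' u ne with u ≟ v
    ... | yes refl = proj₂ (snd-TN _ _ hs)
    ... | no ne'   = trans (cong tok (same u ne' ne)) (others inv u ne')
    live' : ∀ u → Live (lookup s' u)
    live' u with u ≟ v | u ≟ w
    ... | yes refl | _        = live-step hs (live inv u)
    ... | no _     | yes refl = live-step hr (live inv u)
    ... | no ne    | no ne'   = subst Live (sym (same u ne ne')) (live inv u)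

  gstep⇒tokstep : ∀ {s s' v} → GStep P G (lookup s) (lookup s') → Inv s v → ∃[ w ] TokStep s s' v w
  gstep⇒tokstep (internal u a h same) inv = _ , internal u a h same
  gstep⇒tokstep {v = v} (pass u w edge hs hr same) inv with u ≟ v
  ... | yes refl = w , pass edge hs hr same
  ... | no ne    = contradiction (trans (sym (proj₁ (snd-TN _ _ hs))) (others inv u ne)) (λ ())

  edge⇒≢ : ∀ {v w} → Edge v w ≡ true → v ≢ w
  edge⇒≢ {v} e refl = contradiction (trans (sym e) (irrefl v)) (λ ())

  -- Without a pass on it, a cycle would contain an internal cycle of some process.
  module _ {J : Set} {R : J → J → Set} (state : J → VState) (holder : J → Fin n)
           (tokstep : ∀ {x y} → R x y → TokStep (state x) (state y) (holder x) (holder y)) where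

    Passes : J → J → Set
    Passes x y = Edge (holder x) (holder y) ≡ true

    pass-or-internal : ∀ {x y} (w : Star R x y) →
                       AnyEdge Passes w ⊎ (∀ u → Star IntStep (lookup (state x) u) (lookup (state y) u))
    pass-or-internal ε = inj₂ λ u → ε
    pass-or-internal {x} (_◅_ {j = y} r w) = first refl (tokstep r)
      where
      first : ∀ {h} → h ≡ holder y → TokStep (state x) (state y) (holder x) h →
              AnyEdge Passes (r ◅ w) ⊎ (∀ u → Star IntStep (lookup (state x) u) _)
      first eq (pass e _ _ _) = inj₁ (here (subst (λ h → Edge (holder x) h ≡ true) eq e))
      first eq (internal u a h same) with pass-or-internal w
      ... | inj₁ p  = inj₁ (there p)
      ... | inj₂ ss = inj₂ extend
        where
        extend : ∀ v → Star IntStep (lookup (state x) v) _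
        extend v with v ≟ u
        ... | yes refl = (a , h) ◅ ss v
        ... | no ne    = subst (λ q → Star IntStep q _) (same v ne) (ss v)

    cycle-passes : ∀ {x} → (∀ u → Live (lookup (state x) u)) → (w : Star⁺ R x x) → AnyEdge Passes (⁺⇒* w)
    cycle-passes {x} lv (_◂_ {y} r w) = first refl (tokstep r)
      where
      first : ∀ {h} → h ≡ holder y → TokStep (state x) (state y) (holder x) h → AnyEdge Passes (r ◅ w)
      first eq (pass e _ _ _) = here (subst (λ h → Edge (holder x) h ≡ true) eq e)
      first eq (internal u a h same) with pass-or-internal w
      ... | inj₁ p  = there p
      ... | inj₂ ss = contradiction ((a , h) ◂ ss u) (no-internal-cycle (lv u))

  open Tableau VProj

  record XStep (φ : PathF (AP × Fin k)) (x y : Node φ × Fin n) : Set where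
    field
      tstep : TStep φ (proj₁ x) (proj₁ y)
      inv   : Inv (proj₁ (proj₁ x)) (proj₂ x)
      move  : TokStep (proj₁ (proj₁ x)) (proj₁ (proj₁ y)) (proj₂ x) (proj₂ y)

    inv' : Inv (proj₁ (proj₁ y)) (proj₂ y)
    inv' = tokstep-inv move inv

  annotate : ∀ {φ y z v} (w : Star (TStep φ) y z) → Inv (proj₁ y) v →
             ∃[ v' ] (Inv (proj₁ z) v' × Σ (Star (XStep φ) (y , v) (z , v')) λ w' →
               ∀ F → AnyEdge (AtSource F) w → AnyEdge (AtSource {B = Fin n} (λ x _ → F (proj₁ x) (proj₂ x))) w')
  annotate ε inv = _ , inv , ε , λ F ()
  annotate {φ} (r ◅ w) inv =
    let _ , m = gstep⇒tokstep (proj₁ r) inv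
        v' , inv' , w' , keep = annotate {φ} w (tokstep-inv m inv)
    in v' , inv' , record { tstep = r ; inv = inv ; move = m } ◅ w' ,
       λ { F (here h) → here h ; F (there a) → there (keep F a) }

  annotate-loop : ∀ {φ y v} (w : Star⁺ (TStep φ) y y) → Inv (proj₁ y) v →
                  Σ (Star⁺ (XStep φ) (y , v) (y , v)) λ w' →
                  ∀ F → AnyEdge (AtSource F) (⁺⇒* w) →
                        AnyEdge (AtSource {B = Fin n} (λ x _ → F (proj₁ x) (proj₂ x))) (⁺⇒* w')
  annotate-loop {φ} (r ◂ w) inv with gstep⇒tokstep (proj₁ r) inv
  ... | _ , m with annotate {φ} w (tokstep-inv m inv)
  -- The loop returns to the same global state, whose token holder is unique, so the annotated walk
  -- closes as well.
  ...   | _ , inv' , w' , keep with inv-unique inv inv'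
  ...     | refl = record { tstep = r ; inv = inv ; move = m } ◂ w' ,
                   λ { F (here h) → here h ; F (there a) → there (keep F a) }

-- Matching token walks in two topologies.

conj : {AP : Set} → ∀ n → (Fin n → StateF AP) → StateF AP
conj zero    χ = tt
conj (suc n) χ = χ zero ∧ₛ conj n (χ ∘ suc)

module _ {AP : Set} where

  conj-depth : ∀ {d} n (χ : Fin n → StateF AP) → (∀ i → depthS (χ i) ≤ d) → depthS (conj n χ) ≤ d
  conj-depth zero    χ le = z≤n
  conj-depth (suc n) χ le = ⊔-lub (le zero) (conj-depth n (χ ∘ suc) (le ∘ suc))

  conj-intro : ∀ (M : LTS AP) {s} n χ → (∀ i → _⊨ₛ_ M s (χ i)) → _⊨ₛ_ M s (conj n χ)
  conj-intro M zero    χ h = tt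
  conj-intro M (suc n) χ h = h zero , conj-intro M n (χ ∘ suc) (h ∘ suc)

  conj-elim : ∀ (M : LTS AP) {s} n χ → _⊨ₛ_ M s (conj n χ) → ∀ i → _⊨ₛ_ M s (χ i)
  conj-elim M (suc n) χ (h , hs) zero    = h
  conj-elim M (suc n) χ (h , hs) (suc i) = conj-elim M n (χ ∘ suc) hs i

_⊨ᴳ?_ : ∀ {G : Topology} {k} {g : Fin k → Fin (Topology.n G)} v χ → Dec (_⊨ₛ_ (GraphLTS G g) v χ)
_⊨ᴳ?_ {G} {g = g} = Tableau._⊨?_ (GraphLTS G g) (finite-Fin _) (λ u v → Topology.Edge G u v Bool.≟ true)

module Matching {k : ℕ} (G : Topology) (g : Fin k → Fin (Topology.n G))
                (G' : Topology) (g' : Fin k → Fin (Topology.n G')) (e : ℕ) where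
  open Topology G
  open Topology G' using () renaming (n to n'; Edge to Edge')

  private
    T  = GraphLTS G g
    T' = GraphLTS G' g'

  _≈_ : Fin n → Fin n' → Set
  v ≈ p = ∀ χ → depthS χ ≤ e → _⊨ₛ_ T v χ ⇔ _⊨ₛ_ T' p χ

  -- A walk of G' that matches a single step from v to v' (or the absence of a step, if v ≡ v').
  data GWalk (v v' : Fin n) : Fin n' → Fin n' → Set where
    stay : ∀ {p} → v' ≈ p → GWalk v v' p p
    go   : ∀ {p p₁ q} → v ≈ p → Edge' p p₁ ≡ true → GWalk v v' p₁ q → GWalk v v' p q

  Goes : ∀ {v v' p q} → GWalk v v' p q → Set
  Goes (stay _)   = ⊥
  Goes (go _ _ _) = ⊤

  record Characteristic : Set where
    field
      χ        : Fin n → StateF (Fin k)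
      depth    : ∀ v → depthS (χ v) ≤ e
      self     : ∀ v → _⊨ₛ_ T v (χ v)
      separate : ∀ {v p} → _⊨ₛ_ T' p (χ v) → v ≈ p

  -- For each `p`, either `v ≈ p` and `tt` serves, or some formula holds at `v` and fails at `p`;
  -- the conjunction over all `p` characterises `v` in `G'`. Which case occurs is not decided, hence
  -- the double negation.
  characteristic : ¬ ¬ Characteristic
  characteristic =
    ¬¬-∀ (finite-Fin n) (λ v → ¬¬-∀ (finite-Fin n') (distinguish v)) >>= λ ξ → return record
      { χ        = λ v → conj n' (λ p → proj₁ (ξ v p))
      ; depth    = λ v → conj-depth n' _ (λ p → proj₁ (proj₂ (ξ v p)))
      ; self     = λ v → conj-intro T n' _ (λ p → proj₁ (proj₂ (proj₂ (ξ v p))))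
      ; separate = λ {v} {p} h → proj₂ (proj₂ (proj₂ (ξ v p))) (conj-elim T' n' _ h p)
      }
    where
    distinguish : ∀ v p → ¬ ¬ (∃[ χ ] (depthS χ ≤ e × (_⊨ₛ_ T v χ × (_⊨ₛ_ T' p χ → v ≈ p))))
    distinguish v p none = none (tt , z≤n , tt , λ _ χ le → mk⇔
      (λ h → decidable-stable (_⊨ᴳ?_ {G'} {g = g'} p χ) λ k → none (χ , le , h , λ h' → contradiction h' k))
      (λ h → decidable-stable (_⊨ᴳ?_ {G} {g = g} v χ) λ k → none (¬ₛ χ , le , k , λ k' → contradiction h k')))

  module _ {J : Set} {R : J → J → Set} (holder : J → Fin n) where

    data JWalk : ∀ {x y} → Star R x y → Fin n' → Fin n' → Set where
      []  : ∀ {x p} → JWalk {x} ε p p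
      _∷_ : ∀ {x y z p p₁ q} {r : R x y} {w : Star R y z} →
            GWalk (holder x) (holder y) p p₁ → JWalk w p₁ q → JWalk (r ◅ w) p q

    GoesSomewhere : ∀ {x y} {w : Star R x y} {p q} → JWalk w p q → Set
    GoesSomewhere []       = ⊥
    GoesSomewhere (s ∷ ss) = Goes s ⊎ GoesSomewhere ss

    Near : Fin n' → J → J → Set
    Near p x _ = holder x ≈ p

    goes-or-stays : ∀ {x y} {w : Star R x y} {p q} (j : JWalk w p q) → holder x ≈ p →
                    GoesSomewhere j ⊎ AllEdges (Near p) w
    goes-or-stays []                e = inj₂ []
    goes-or-stays (go _ _ _ ∷ _)    e = inj₁ (inj₁ tt)
    goes-or-stays (stay e' ∷ j)     e with goes-or-stays j e'
    ... | inj₁ g   = inj₁ (inj₂ g)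
    ... | inj₂ all = inj₂ (e ∷ all)

    stays-near : ∀ {x y} {w : Star R x y} {p} → AllEdges (Near p) w → holder y ≈ p → holder x ≈ p
    stays-near []      e = e
    stays-near (e ∷ _) _ = e

    stay-at : ∀ {x y} {w : Star R x y} {p q} → AllEdges (Near p) w → holder y ≈ p →
              (∀ {v} → v ≈ p → v ≈ q) → JWalk w q q
    stay-at []       e f = []
    stay-at (_ ∷ es) e f = stay (f (stays-near es e)) ∷ stay-at es e f

    _++ʲ_ : ∀ {x y z} {w : Star R x y} {w' : Star R y z} {p q r} →
            JWalk w p q → JWalk w' q r → JWalk (w ◅◅ w') p r
    []      ++ʲ j' = j'
    (s ∷ j) ++ʲ j' = s ∷ (j ++ʲ j')

    goes-++ : ∀ {x y z} {w : Star R x y} {w' : Star R y z} {p q r} (j : JWalk w p q) (j' : JWalk w' q r) →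
              GoesSomewhere j → GoesSomewhere (j ++ʲ j')
    goes-++ (s ∷ j) j' (inj₁ g) = inj₁ g
    goes-++ (s ∷ j) j' (inj₂ g) = inj₂ (goes-++ j j' g)

    -- A lasso of token positions of G and a matching infinite walk of G' that keeps moving.
    record Matched {x c : J} (stem : Star R x c) (loop : Star⁺ R c c) (p : Fin n') : Set₁ where
      field
        K     : Set
        k₀    : K
        next  : K → K
        place : K → Fin n'
        {stem'} : Star R x c
        into  : JWalk stem' p (place k₀)
        -- This may run through `loop` several times, since the token of `G'` may return to a vertex
        -- only after several laps.
        loop' : K → Star⁺ R c c
        lap   : ∀ κ → JWalk (⁺⇒* (loop' κ)) (place κ) (place (next κ))
        goes  : ∀ κ → GoesSomewhere (lap κ)
        keeps : ∀ κ {Q} → AnyEdge Q (⁺⇒* loop) → AnyEdge Q (⁺⇒* (loop' κ))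

    module _ (C : Characteristic)
             (move : ∀ {x y} → R x y → holder x ≡ holder y ⊎ Edge (holder x) (holder y) ≡ true)
             {x c : J} (stem : Star R x c) (loop : Star⁺ R c c)
             (passes : AnyEdge (λ x y → Edge (holder x) (holder y) ≡ true) (⁺⇒* loop)) where
      open Characteristic C

      -- The conjunct in front fixes the class at the current position even when the until is
      -- fulfilled at once; it also gives the class at the position where the preceding until ends.
      chain : ∀ {x y} → Star R x y → PathF (Fin k) → PathF (Fin k)
      chain {x} ε       ω = st (χ (holder x)) ∧ₚ ω
      chain {x} (_ ◅ w) ω = st (χ (holder x)) ∧ₚ (st (χ (holder x)) U chain w ω)

      laps : ℕ → PathF (Fin k) → PathF (Fin k)
      laps zero    ω = ω
      laps (suc m) ω = chain (⁺⇒* loop) (laps m ω)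

      chain-depth : ∀ {x y ω} (w : Star R x y) → depthP ω ≤ e → depthP (chain w ω) ≤ e
      chain-depth ε       le = ⊔-lub (depth _) le
      chain-depth (_ ◅ w) le = ⊔-lub (depth _) (⊔-lub (depth _) (chain-depth w le))

      laps-depth : ∀ {ω} m → depthP ω ≤ e → depthP (laps m ω) ≤ e
      laps-depth zero    le = le
      laps-depth (suc m) le = chain-depth (⁺⇒* loop) (laps-depth m le)

      open Unfold {K = ⊤} (λ _ → c) id (λ _ → loop)

      private
        start : Config
        start = config tt x stem

        h : ℕ → Fin n
        h i = holder (at start i)

      AtLoop : PathF (Fin k) → Set
      AtLoop ω = ∀ j → run start j ≡ config tt c ε → Holds (Along T h) ω j

      at-pos : ∀ {i y} {w : Star R y c} → run start i ≡ config tt y w → _⊨ₛ_ T (h i) (χ (holder y))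
      at-pos {i} eq = subst (λ y → _⊨ₛ_ T (h i) (χ (holder y))) (cong pos eq) (self (h i))

      chain-holds : ∀ {ω} → AtLoop ω → ∀ i {y} (w : Star R y c) → run start i ≡ config tt y w →
                    Holds (Along T h) (chain w ω) i
      chain-holds end i ε       eq = at-pos {i} eq , end i eq
      chain-holds end i (r ◅ w) eq =
        at-pos {i} eq , there (at-pos {i} eq) (here (chain-holds end (suc i) w (cong advance eq)))

      laps-hold : ∀ {ω} m → AtLoop ω → AtLoop (laps m ω)
      laps-hold zero    end = end
      laps-hold (suc m) end j eq =
        at-pos {j} eq ,
        there (at-pos {j} eq) (here (chain-holds (laps-hold m end) (suc j) (Star⁺.rest loop) (cong advance eq)))

      -- The token stutters during internal steps but moves in every lap, so `Collapse` turns its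
      -- positions into a path of `G`.
      source-formula : ∀ {ω} → AtLoop ω → _⊨ₛ_ T (holder x) (E (chain stem ω))
      source-formula {ω} end =
        Collapse.holds⇒E T h (λ i → move (edge (run start i))) (visits start (λ _ → passes))
          (chain stem ω) (chain-holds end 0 stem refl)

      module _ (q : Path T') where

        private
          p : ℕ → Fin n'
          p = Path.at q

        chain-head : ∀ {x y ω} (w : Star R x y) {t} → Holds (Along T' p) (chain w ω) t → holder x ≈ p t
        chain-head ε       (h , _) = separate h
        chain-head (_ ◅ w) (h , _) = separate h

        -- Each until is read off `q`: the positions before its fulfilment become `go`, the
        -- fulfilment becomes `stay`.
        follow : ∀ {x y ω} (w : Star R x y) t → Holds (Along T' p) (chain w ω) t →
                 ∃[ t' ] (JWalk w (p t) (p t') × (holder y ≈ p t' × Holds (Along T' p) ω t'))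
        follow-until : ∀ {x y z ω} {r : R x y} (w : Star R y z) t →
                       Until (λ t → _⊨ₛ_ T' (p t) (χ (holder x))) (Holds (Along T' p) (chain w ω)) t →
                       ∃[ t₁ ] (GWalk (holder x) (holder y) (p t) (p t₁) × Holds (Along T' p) (chain w ω) t₁)

        follow-until w t (here h)    = t , stay (chain-head w h) , h
        follow-until {r = r} w t (there h u) =
          let t₁ , s , h' = follow-until {r = r} w (suc t) u in t₁ , go (separate h) (Path.step q t) s , h'

        follow ε       t (h , hω) = t , [] , separate h , hω
        follow (r ◅ w) t (_ , u)  =
          let t₁ , s , h'      = follow-until {r = r} w t u
              t' , j , e' , hω = follow w t₁ h'
          in t' , s ∷ j , e' , hω

        record Lap (u u' : Fin n') : Set where
          constructor mkLap
          field
            near : holder c ≈ u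
            walk : JWalk (⁺⇒* loop) u u'

        data LapSeq : ℕ → Fin n' → Set where
          end : ∀ {u} → LapSeq 0 u
          _∷_ : ∀ {m u u'} → Lap u u' → LapSeq m u' → LapSeq (suc m) u

        at-lap : ∀ {m u} → LapSeq m u → Fin (suc m) → Fin n'
        at-lap {u = u} _  zero    = u
        at-lap (_ ∷ ls)   (suc i) = at-lap ls i

        to-lap : ∀ {m u} (ls : LapSeq m u) i → Star Lap u (at-lap ls i)
        to-lap ls       zero    = ε
        to-lap (l ∷ ls) (suc i) = l ◅ to-lap ls i

        between : ∀ {m u} (ls : LapSeq m u) i j → i Fin.< j → Star⁺ Lap (at-lap ls i) (at-lap ls j)
        between (l ∷ ls) zero    (suc j) lt       = l ◂ to-lap ls j
        between (l ∷ ls) (suc i) (suc j) (s≤s lt) = between ls i j lt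

        follow-laps : ∀ {ω} m t → holder c ≈ p t → Holds (Along T' p) (laps m ω) t → LapSeq m (p t)
        follow-laps zero    t e' h = end
        follow-laps (suc m) t e' h =
          let t' , j , e'' , h' = follow (⁺⇒* loop) t h in mkLap e' j ∷ follow-laps m t' e'' h'

        unroll : ∀ {u u'} → Star Lap u u' → Σ (Star R c c) λ w → JWalk w u u'
        unroll ε        = ε , []
        unroll (l ◅ ls) = let w , j = unroll ls in ⁺⇒* loop ◅◅ w , Lap.walk l ++ʲ j

      -- If a lap of the loop does not move the token of G', all its positions are in one class, and the
      -- G'-walk is obtained from a path that remains in that class.
      stationary : ∀ {u p₀} → AllEdges (Near u) (⁺⇒* loop) → holder c ≈ u →
                   (∀ ω → depthP ω ≤ e → _⊨ₛ_ T (holder x) (E ω) → _⊨ₛ_ T' p₀ (E ω)) →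
                   Matched stem loop p₀
      stationary {u} {p₀} near c≈u transfer-E = build (transfer-E (chain stem remain)
          (chain-depth stem (⊔-lub z≤n (depth _)))
          (source-formula λ j eq → remains j (subst (λ c → AllEdges InClass (rest c)) (sym eq) [])))
        where
        remain : PathF (Fin k)
        remain = ¬ₚ (st tt U (¬ₚ (st (χ (holder c)))))

        InClass : J → J → Set
        InClass y _ = _⊨ₛ_ T (holder y) (χ (holder c))

        good : ∀ {y z} {w : Star R y z} → AllEdges (Near u) w → AllEdges InClass w
        good []       = []
        good (y≈u ∷ es) = from (y≈u _ (depth _)) (to (c≈u _ (depth _)) (self _)) ∷ good es

        remains : ∀ j → AllEdges InClass (rest (run start j)) → Holds (Along T h) remain j
        remains j all (here k)     = k (proj₁ (stays (λ _ → good near) (run start j) all))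
        remains j all (there _ u') = remains (suc j) (proj₂ (stays (λ _ → good near) (run start j) all)) u'

        build : _⊨ₛ_ T' p₀ (E (chain stem remain)) → Matched stem loop p₀
        build (q , refl , sat) = finish
          (follow q {ω = remain} stem 0 (to (⊨⇔holds T' (Path.at q) q 0 (λ _ → refl) (chain stem remain)) sat))
          where
          p : ℕ → Fin n'
          p = Path.at q

          class : ∀ {t} → Holds (Along T' p) remain t → holder c ≈ p t
          class {t} hω = separate (decidable-stable (_⊨ᴳ?_ {G'} {g = g'} (p t) _) λ k → hω (here k))

          near-to : ∀ {t} → Holds (Along T' p) remain t → ∀ {v} → v ≈ u → v ≈ p t
          near-to hω v≈u χ le = mk⇔
            (λ h → to (class hω χ le) (from (c≈u χ le) (to (v≈u χ le) h)))
            (λ h → from (v≈u χ le) (to (c≈u χ le) (from (class hω χ le) h)))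

          -- A lap uses exactly one edge of `q`, in its first step, and waits at the new vertex for
          -- the rest; so the walk moves in every lap.
          first-step : ∀ t → Holds (Along T' p) remain t → Holds (Along T' p) remain (suc t) →
                       AllEdges (Near u) (⁺⇒* loop) →
                       Σ (JWalk (⁺⇒* loop) (p t) (p (suc t))) GoesSomewhere
          first-step t hω hω' (y≈u ∷ es) =
            (go (near-to hω y≈u) (Path.step q t) (stay (near-to hω' (stays-near es c≈u)))
              ∷ stay-at es c≈u (near-to hω')) , inj₁ tt

          finish : ∃[ t ] (JWalk stem (p 0) (p t) × (holder c ≈ p t × Holds (Along T' p) remain t)) →
                   Matched stem loop (p 0)
          finish (t₀ , into , _ , hω₀) = record
            -- Laps are indexed by the positions of `q`, which need not be periodic.
            { K     = ∃[ t ] Holds (Along T' p) remain t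
            ; k₀    = t₀ , hω₀
            ; next  = λ (t , hω) → suc t , λ u' → hω (there tt u')
            ; place = λ (t , _) → p t
            ; into  = into
            ; loop' = λ _ → loop
            ; lap   = λ (t , hω) → proj₁ (first-step t hω (λ u' → hω (there tt u')) near)
            ; goes  = λ (t , hω) → proj₂ (first-step t hω (λ u' → hω (there tt u')) near)
            ; keeps = λ _ a → a
            }

      matched : ∀ {p₀} → (∀ ω → depthP ω ≤ e → _⊨ₛ_ T (holder x) (E ω) → _⊨ₛ_ T' p₀ (E ω)) →
                Matched stem loop p₀
      matched {p₀} transfer-E = build (transfer-E (chain stem (laps n' (st tt)))
          (chain-depth stem (laps-depth n' z≤n)) (source-formula (laps-hold n' (λ _ _ → tt))))
        where
        build : _⊨ₛ_ T' p₀ (E (chain stem (laps n' (st tt)))) → Matched stem loop p₀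
        build (q , refl , sat)
          with follow q {ω = laps n' (st tt)} stem 0
                 (to (⊨⇔holds T' (Path.at q) q 0 (λ _ → refl) (chain stem (laps n' (st tt)))) sat)
        -- The `n'` laps have `n' + 1` end points among `n'` vertices, so two end points coincide.
        ... | t , into , c≈ , hω = repeat (pigeonhole ≤-refl (at-lap q ls))
          where
          ls : LapSeq q n' (Path.at q t)
          ls = follow-laps q {st tt} n' t c≈ hω

          cycle : ∀ {u} → Star (Lap q) (Path.at q t) u → Star⁺ (Lap q) u u → Matched stem loop (Path.at q 0)
          cycle {u} pre (mkLap c≈u j ◂ more) with goes-or-stays j c≈u
          -- The lap found only shows that the loop stays in one class; `stationary` then obtains
          -- another path of `G'`.
          ... | inj₂ near = stationary near c≈u transfer-E
          ... | inj₁ gs   = record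
            { K     = ⊤
            ; k₀    = tt
            ; next  = id
            ; place = λ _ → u
            ; into  = into ++ʲ proj₂ (unroll q pre)
            ; loop' = λ _ → loop ⁺◅◅ proj₁ (unroll q more)
            ; lap   = λ _ → j ++ʲ proj₂ (unroll q more)
            ; goes  = λ _ → goes-++ j (proj₂ (unroll q more)) gs
            ; keeps = λ _ → any-++ˡ (proj₁ (unroll q more))
            }

          repeat : ∃[ i ] ∃[ j ] (i Fin.< j × at-lap q ls i ≡ at-lap q ls j) → Matched stem loop (Path.at q 0)
          repeat (i , j , lt , eq) =
            cycle (to-lap q ls i) (subst (Star⁺ (Lap q) _) (sym eq) (between q ls i j lt))

-- Simulation of a run along the matching walk.

module Simulation {AP : Set} (P : ProcTemplate AP) {k : ℕ}
                  (G : Topology) (g : Fin k → Fin (Topology.n G)) (g-inj : Injective _≡_ _≡_ g)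
                  (G' : Topology) (g' : Fin k → Fin (Topology.n G')) (g'-inj : Injective _≡_ _≡_ g')
                  (e : ℕ) where
  open ProcTemplate P
  open Local P
  open Topology G using (n; Edge)
  open Topology G' using () renaming (n to n'; Edge to Edge')
  open Matching G g G' g' e

  private
    module S  = System P G g
    module S' = System P G' g'

  open S using (VState; VProj; Inv; TokStep; XStep; internal; pass)
  open S' using () renaming (VState to VState'; VProj to VProj'; Inv to Inv'; TokStep to TokStep')
  open Tableau VProj using (Node; Consistent; Asg)

  -- The atom `i` holds at the vertex `g i` only and has depth 0, so `≈` preserves it at every
  -- level.
  observed : ∀ {v p i} → v ≈ p → g i ≡ v → g' i ≡ p
  observed {p = p} {i} v≈p refl with g' i ≟ p | to (v≈p (atom i) z≤n) (dec-true (g i ≟ g i) refl)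
  ... | yes eq | _ = eq

  observed⁻ : ∀ {v p i} → v ≈ p → g' i ≡ p → g i ≡ v
  observed⁻ {v = v} {i = i} v≈p refl with g i ≟ v | from (v≈p (atom i) z≤n) (dec-true (g' i ≟ g' i) refl)
  ... | yes eq | _ = eq

  record Rel (s : VState) (v : Fin n) (z : VState') (p : Fin n') : Set where
    field
      inv  : Inv s v
      inv' : Inv' z p
      obs  : ∀ i → lookup s (g i) ≡ lookup z (g' i)
      near : v ≈ p

  open Rel public

  module _ {φ : PathF (AP × Fin k)} where

    X : Set
    X = Node φ × Fin n

    holder : X → Fin n
    holder = proj₂

    Joint : Set
    Joint = X × (VState' × Fin n')

    -- Either side may stutter. The relation and the consistency of the assignment are stored at the
    -- source, hence available at every position of an infinite joint run.
    record JStep (j j' : Joint) : Set where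
      field
        rel        : Rel (proj₁ (proj₁ (proj₁ j))) (proj₂ (proj₁ j)) (proj₁ (proj₂ j)) (proj₂ (proj₂ j))
        consistent : Consistent φ (proj₁ (proj₁ (proj₁ j))) (proj₂ (proj₁ (proj₁ j)))
        left       : proj₁ j ≡ proj₁ j' ⊎ XStep φ (proj₁ j) (proj₁ j')
        right      : proj₁ (proj₂ j) ≡ proj₁ (proj₂ j') ⊎
                     GStep P G' (lookup (proj₁ (proj₂ j))) (lookup (proj₁ (proj₂ j')))

    Real : Joint → Joint → Set
    Real j j' = GStep P G' (lookup (proj₁ (proj₂ j))) (lookup (proj₁ (proj₂ j')))

    module _ {y : Node φ} {v : Fin n} (con : Consistent φ (proj₁ y) (proj₂ y)) where

      private
        s : VState
        s = proj₁ y

      -- The process at `u` is unobserved, so its internal steps keep the relation while the left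
      -- side stands still.
      quiet : ∀ {z p u q r} → (∀ i → g' i ≢ u) → Rel s v z p → lookup z u ≡ q → Star IntStep q r →
              ∃[ z₁ ] (Star JStep ((y , v) , z , p) ((y , v) , z₁ , p) × Rel s v z₁ p ×
                       lookup z₁ u ≡ r × (∀ w → w ≢ u → lookup z₁ w ≡ lookup z w))
      quiet unobs rel eq ε = _ , ε , rel , eq , λ _ _ → refl
      quiet {z} {p} {u} {q} unobs rel eq (_◅_ {j = q₁} (a , h) w) =
        let z₂ , w' , rel' , eq' , same' = quiet unobs rel₁ (lookup∘update u z q₁) w
        in z₂ , step ◅ w' , rel' , eq' , λ x ne → trans (same' x ne) (lookup∘update′ ne z q₁)
        where
        z₁ : VState'
        z₁ = z [ u ]≔ q₁

        move₁ : TokStep' z z₁ p p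
        move₁ = S'.internal u a (subst₂ (λ q q' → δ q (int a) q' ≡ true) (sym eq) (sym (lookup∘update u z q₁)) h)
                            (λ x ne → lookup∘update′ ne z q₁)

        rel₁ : Rel s v z₁ p
        rel₁ = record
          { inv  = inv rel
          ; inv' = S'.tokstep-inv move₁ (inv' rel)
          ; obs  = λ i → trans (obs rel i) (sym (lookup∘update′ (unobs i) z q₁))
          ; near = near rel }

        step : JStep ((y , v) , z , p) ((y , v) , z₁ , p)
        step = record { rel = rel ; consistent = con ; left = inj₁ refl ; right = inj₂ (S'.tokstep⇒gstep move₁) }

      -- Makes `u` able to send or receive. An observed `u` shares the local state of its partner,
      -- which by `enabled` can act already, with target `τ i`; an unobserved one is driven there by
      -- `ready`.
      prepare : ∀ {z p} b u (τ : Fin k → Fin nQ) → Rel s v z p → tok (lookup z u) ≡ b →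
                (∀ i → g' i ≡ u → δ (lookup s (g i)) (transfer b) (τ i) ≡ true) →
                ∃[ z₁ ] ∃[ r ] (Star JStep ((y , v) , z , p) ((y , v) , z₁ , p) × Rel s v z₁ p ×
                  (∀ w → w ≢ u → lookup z₁ w ≡ lookup z w) × δ (lookup z₁ u) (transfer b) r ≡ true ×
                  (∀ i → g' i ≡ u → r ≡ τ i))
      prepare {z} {p} b u τ rel tok≡b enabled with any? (λ i → g' i ≟ u)
      ... | yes (i , refl) = z , τ i , ε , rel , (λ _ _ → refl) ,
        subst (λ q → δ q (transfer b) (τ i) ≡ true) (obs rel i) (enabled i refl) ,
        λ j eq → cong τ (sym (g'-inj eq))
      ... | no unobs =
        let r , w , r' , h = ready (S'.live (inv' rel) u)
            z₁ , w' , rel' , eq , same = quiet (λ i eq → unobs (i , eq)) rel refl w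
        in z₁ , r' , w' , rel' , same ,
           subst₂ (λ q b → δ q (transfer b) r' ≡ true) (sym eq) tok≡b h ,
           λ i eq → contradiction (i , eq) unobs

      -- Serves both for copying a pass of `G` and for a pass in `G'` alone, depending on the left
      -- step. The sender is prepared before the receiver; as `p` and `p₁` differ, preparing the
      -- receiver leaves the sender untouched.
      simulate-pass : ∀ {z p p₁} {y' : Node φ} {v'} → Rel s v z p → Edge' p p₁ ≡ true →
        (y , v) ≡ (y' , v') ⊎ XStep φ (y , v) (y' , v') → Inv (proj₁ y') v' → v' ≈ p₁ →
        (∀ i → g' i ≡ p → δ (lookup s (g i)) snd (lookup (proj₁ y') (g i)) ≡ true) →
        (∀ i → g' i ≡ p₁ → δ (lookup s (g i)) rcv (lookup (proj₁ y') (g i)) ≡ true) →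
        (∀ i → g' i ≢ p → g' i ≢ p₁ → lookup (proj₁ y') (g i) ≡ lookup s (g i)) →
        ∃[ z' ] (Rel (proj₁ y') v' z' p₁ ×
          Σ (Star⁺ JStep ((y , v) , z , p) ((y' , v') , z' , p₁)) λ w → AnyEdge Real (⁺⇒* w))
      simulate-pass {z} {p} {p₁} {y'} {v'} rel edge left-step inv-y' v'≈p₁ sends receives idle =
        first (prepare true p τ rel (S'.token (inv' rel)) sends)
        where
        τ : Fin k → Fin nQ
        τ i = lookup (proj₁ y') (g i)

        p≢p₁ : p ≢ p₁
        p≢p₁ = S'.edge⇒≢ edge

        Result : Set
        Result = ∃[ z' ] (Rel (proj₁ y') v' z' p₁ ×
          Σ (Star⁺ JStep ((y , v) , z , p) ((y' , v') , z' , p₁)) λ w → AnyEdge Real (⁺⇒* w))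

        finish : ∀ z₂ q₁ q₂ → Star JStep ((y , v) , z , p) ((y , v) , z₂ , p) → Rel s v z₂ p →
                 δ (lookup z₂ p) snd q₁ ≡ true → (∀ i → g' i ≡ p → q₁ ≡ τ i) →
                 δ (lookup z₂ p₁) rcv q₂ ≡ true → (∀ i → g' i ≡ p₁ → q₂ ≡ τ i) → Result
        finish z₂ q₁ q₂ w rel₂ hs o₁ hr o₂ =
          z' , rel' , w ◅◅⁺ (step ◂ ε) , any-◅◅⁺ w (here gstep)
          where
          z' : VState'
          z' = (z₂ [ p ]≔ q₁) [ p₁ ]≔ q₂

          at-p : lookup z' p ≡ q₁
          at-p = trans (lookup∘update′ p≢p₁ (z₂ [ p ]≔ q₁) q₂) (lookup∘update p z₂ q₁)

          at-p₁ : lookup z' p₁ ≡ q₂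
          at-p₁ = lookup∘update p₁ (z₂ [ p ]≔ q₁) q₂

          elsewhere : ∀ u → u ≢ p → u ≢ p₁ → lookup z' u ≡ lookup z₂ u
          elsewhere u ne ne₁ = trans (lookup∘update′ ne₁ (z₂ [ p ]≔ q₁) q₂) (lookup∘update′ ne z₂ q₁)

          move' : TokStep' z₂ z' p p₁
          move' = S'.pass edge (subst (λ q → δ (lookup z₂ p) snd q ≡ true) (sym at-p) hs)
                          (subst (λ q → δ (lookup z₂ p₁) rcv q ≡ true) (sym at-p₁) hr) elsewhere

          gstep : GStep P G' (lookup z₂) (lookup z')
          gstep = S'.tokstep⇒gstep move'

          obs' : ∀ i → τ i ≡ lookup z' (g' i)
          obs' i = cases (g' i ≟ p) (g' i ≟ p₁)
            where
            cases : Dec (g' i ≡ p) → Dec (g' i ≡ p₁) → τ i ≡ lookup z' (g' i)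
            cases (yes eq) _        = trans (sym (o₁ i eq)) (trans (sym at-p) (cong (lookup z') (sym eq)))
            cases (no _)   (yes eq) = trans (sym (o₂ i eq)) (trans (sym at-p₁) (cong (lookup z') (sym eq)))
            cases (no ne)  (no ne₁) =
              trans (idle i ne ne₁) (trans (obs rel₂ i) (sym (elsewhere (g' i) ne ne₁)))

          rel' : Rel (proj₁ y') v' z' p₁
          rel' = record { inv = inv-y' ; inv' = S'.tokstep-inv move' (inv' rel₂) ; obs = obs' ; near = v'≈p₁ }

          step : JStep ((y , v) , z₂ , p) ((y' , v') , z' , p₁)
          step = record { rel = rel₂ ; consistent = con ; left = left-step ; right = inj₂ gstep }

        second : ∀ z₁ q₁ → Star JStep ((y , v) , z , p) ((y , v) , z₁ , p) →
                 δ (lookup z₁ p) snd q₁ ≡ true → (∀ i → g' i ≡ p → q₁ ≡ τ i) →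
                 ∃[ z₂ ] ∃[ r ] (Star JStep ((y , v) , z₁ , p) ((y , v) , z₂ , p) × Rel s v z₂ p ×
                   (∀ w → w ≢ p₁ → lookup z₂ w ≡ lookup z₁ w) × δ (lookup z₂ p₁) rcv r ≡ true ×
                   (∀ i → g' i ≡ p₁ → r ≡ τ i)) → Result
        second z₁ q₁ w₁ hs o₁ (z₂ , q₂ , w₂ , rel₂ , same , hr , o₂) =
          finish z₂ q₁ q₂ (w₁ ◅◅ w₂) rel₂ (subst (λ q → δ q snd q₁ ≡ true) (sym (same p p≢p₁)) hs) o₁ hr o₂

        first : ∃[ z₁ ] ∃[ r ] (Star JStep ((y , v) , z , p) ((y , v) , z₁ , p) × Rel s v z₁ p ×
                  (∀ w → w ≢ p → lookup z₁ w ≡ lookup z w) × δ (lookup z₁ p) snd r ≡ true ×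
                  (∀ i → g' i ≡ p → r ≡ τ i)) → Result
        first (z₁ , q₁ , w₁ , rel₁ , _ , hs , o₁) =
          second z₁ q₁ w₁ hs o₁
            (prepare false p₁ τ rel₁ (S'.others (inv' rel₁) p₁ (λ eq → p≢p₁ (sym eq))) receives)

      -- Both ends of the edge match `v`, and they differ, so neither is observed and the conditions
      -- on observed senders and receivers are vacuous.
      quiet-pass : ∀ {z p p₁} → Rel s v z p → Edge' p p₁ ≡ true → v ≈ p₁ →
        ∃[ z' ] (Rel s v z' p₁ ×
          Σ (Star⁺ JStep ((y , v) , z , p) ((y , v) , z' , p₁)) λ w → AnyEdge Real (⁺⇒* w))
      quiet-pass rel edge v≈p₁ = simulate-pass rel edge (inj₁ refl) (inv rel) v≈p₁
        (λ i eq → contradiction (trans (sym eq) (observed v≈p₁ (observed⁻ (near rel) eq))) (S'.edge⇒≢ edge))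
        (λ i eq → contradiction (trans (sym (observed (near rel) (observed⁻ v≈p₁ eq))) eq) (S'.edge⇒≢ edge))
        (λ _ _ _ → refl)

      -- An internal step of an observed process is copied. One of an unobserved process is
      -- invisible, as is a pass inside one class, and the right side stutters.
      simulate-stay : ∀ {z p} {y' : Node φ} {v'} → XStep φ (y , v) (y' , v') →
        TokStep s (proj₁ y') v v' → Rel s v z p → v' ≈ p →
        ∃[ z' ] (Rel (proj₁ y') v' z' p × Star⁺ JStep ((y , v) , z , p) ((y' , v') , z' , p))
      simulate-stay {z} {p} {y'} xs (internal u a h same) rel v'≈p with any? (λ i → g i ≟ u)
      ... | yes (i , refl) = z' , rel' ,
        record { rel = rel ; consistent = con ; left = inj₂ xs ; right = inj₂ (S'.tokstep⇒gstep move') } ◂ ε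
        where
        q : Fin nQ
        q = lookup (proj₁ y') (g i)

        z' : VState'
        z' = z [ g' i ]≔ q

        move' : TokStep' z z' p p
        move' = S'.internal (g' i) a
          (subst₂ (λ q q' → δ q (int a) q' ≡ true) (obs rel i) (sym (lookup∘update (g' i) z q)) h)
          (λ w ne → lookup∘update′ ne z q)

        obs' : ∀ j → lookup (proj₁ y') (g j) ≡ lookup z' (g' j)
        obs' j = cases (j ≟ i)
          where
          cases : Dec (j ≡ i) → lookup (proj₁ y') (g j) ≡ lookup z' (g' j)
          cases (yes refl) = sym (lookup∘update (g' i) z q)
          cases (no ne)    = trans (same (g j) (λ eq → ne (g-inj eq)))
            (trans (obs rel j) (sym (lookup∘update′ (λ eq → ne (g'-inj eq)) z q)))

        rel' : Rel (proj₁ y') v z' p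
        rel' = record { inv = XStep.inv' xs ; inv' = S'.tokstep-inv move' (inv' rel) ; obs = obs' ; near = v'≈p }
      ... | no unobs = z ,
        record { inv = XStep.inv' xs ; inv' = inv' rel ; near = v'≈p
               ; obs = λ i → trans (same (g i) (λ eq → unobs (i , eq))) (obs rel i) } ,
        record { rel = rel ; consistent = con ; left = inj₂ xs ; right = inj₁ refl } ◂ ε
      simulate-stay {z} {p} {y'} {v'} xs (pass edge hs hr same) rel v'≈p = z ,
        record { inv = XStep.inv' xs ; inv' = inv' rel ; near = v'≈p
               ; obs = λ i → trans (same (g i) (not-v i) (not-v' i)) (obs rel i) } ,
        record { rel = rel ; consistent = con ; left = inj₂ xs ; right = inj₁ refl } ◂ ε
        where
        -- v and v' are distinct but both match p, so neither is observed.
        not-v : ∀ i → g i ≢ v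
        not-v i eq = S.edge⇒≢ edge (trans (sym eq) (observed⁻ v'≈p (observed (near rel) eq)))
        not-v' : ∀ i → g i ≢ v'
        not-v' i eq = S.edge⇒≢ edge (trans (sym (observed⁻ (near rel) (observed v'≈p eq))) eq)

      -- For a pass in `G`, the last edge of the walk in `G'`, if there is one, copies it and the
      -- earlier edges are quiet. For an internal step all edges are quiet and the step itself is
      -- simulated after them.
      simulate-step : ∀ {z p p'} {y' : Node φ} {v'} → XStep φ (y , v) (y' , v') →
        TokStep s (proj₁ y') v v' → Rel s v z p → (m : GWalk v v' p p') →
        ∃[ z' ] (Rel (proj₁ y') v' z' p' ×
          Σ (Star⁺ JStep ((y , v) , z , p) ((y' , v') , z' , p')) λ w → Goes m → AnyEdge Real (⁺⇒* w))

      quiet-then : ∀ {z p p₁ p'} {y' : Node φ} {v'} → XStep φ (y , v) (y' , v') →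
        TokStep s (proj₁ y') v v' → Rel s v z p → Edge' p p₁ ≡ true → v ≈ p₁ → GWalk v v' p₁ p' →
        ∃[ z' ] (Rel (proj₁ y') v' z' p' ×
          Σ (Star⁺ JStep ((y , v) , z , p) ((y' , v') , z' , p')) λ w → ⊤ → AnyEdge Real (⁺⇒* w))

      simulate-step xs m rel (stay v'≈p) =
        let z' , rel' , w = simulate-stay xs m rel v'≈p in z' , rel' , w , λ ()
      simulate-step xs m rel (go _ edge (go v≈p₁ edge' rest)) =
        quiet-then xs m rel edge v≈p₁ (go v≈p₁ edge' rest)
      simulate-step xs m@(internal _ _ _ _) rel (go _ edge (stay v≈p₁)) =
        quiet-then xs m rel edge v≈p₁ (stay v≈p₁)
      simulate-step {y' = y'} xs (pass _ hs hr same) rel (go _ edge (stay v'≈p₁)) =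
        let z' , rel' , w , real = simulate-pass rel edge (inj₂ xs) (XStep.inv' xs) v'≈p₁
              (λ i eq → subst (λ u → δ (lookup s u) snd (lookup (proj₁ y') u) ≡ true) (sym (observed⁻ (near rel) eq)) hs)
              (λ i eq → subst (λ u → δ (lookup s u) rcv (lookup (proj₁ y') u) ≡ true) (sym (observed⁻ v'≈p₁ eq)) hr)
              (λ i ne ne₁ → same (g i) (λ eq → ne (observed (near rel) eq)) (λ eq → ne₁ (observed v'≈p₁ eq)))
        in z' , rel' , w , λ _ → real

      quiet-then xs m rel edge v≈p₁ rest =
        let z₁ , rel₁ , w₁ , real = quiet-pass rel edge v≈p₁
            z' , rel' , w , _ = simulate-step xs m rel₁ rest
        in z' , rel' , w₁ ⁺◅◅ ⁺⇒* w , λ _ → any-⁺◅◅ w₁ (⁺⇒* w) real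

    AtX : (X → Set) → Joint → Joint → Set
    AtX F j _ = F (proj₁ j)

    record Simulated {x x' : X} (w : Star (XStep φ) x x') {p p'} (m : JWalk holder w p p') (z : VState') : Set₁ where
      field
        {final} : VState'
        rel'    : Rel (proj₁ (proj₁ x')) (proj₂ x') final p'
        walk    : Star JStep (x , z , p) (x' , final , p')
        real    : GoesSomewhere holder m → AnyEdge Real walk
        keeps   : ∀ {F : X → Set} → AnyEdge (λ x _ → F x) w → AnyEdge (AtX F) walk

    simulate : ∀ {x x'} {w : Star (XStep φ) x x'} {p p'} (m : JWalk holder w p p') {z} →
               Rel (proj₁ (proj₁ x)) (proj₂ x) z p → Simulated w m z
    simulate [] rel = record { rel' = rel ; walk = ε ; real = λ () ; keeps = λ () }
    simulate {x} (_∷_ {r = r} s m) rel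
      with simulate-step (proj₁ (proj₂ (XStep.tstep r))) r (XStep.move r) rel s
    ... | z₁ , rel₁ , w₁ , real₁ = record
      { rel'  = Simulated.rel' rest
      ; walk  = ⁺⇒* w₁ ◅◅ Simulated.walk rest
      ; real  = [ (λ gs → any-++ˡ (Simulated.walk rest) (real₁ gs))
                , (λ gs → any-++ʳ (⁺⇒* w₁) (Simulated.real rest gs)) ]′
      -- The joint walk for an edge is nonempty and starts with the source of that edge on the left,
      -- so a fairness visit at the source survives.
      ; keeps = λ { (here f)  → here f
                  ; (there a) → any-++ʳ (⁺⇒* w₁) (Simulated.keeps rest a) }
      }
      where
      rest : Simulated _ m z₁
      rest = simulate m rel₁

  module _ (agree : ∀ χ → depthS χ ≤ e → ∀ {s v z p} → Rel s v z p → _⊨ₛ_ VProj s χ ⇔ _⊨ₛ_ VProj' z χ)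
           (φ : PathF (AP × Fin k)) (φ-depth : depthP φ ≤ e) where
    open Tableau VProj using (TStep; Lasso; good⇒lasso; E⇒good; FairAll; fair-map; truth; linked-refl; Linked; Val)

    module _ {s : VState} {v : Fin n} {z : VState'} {p : Fin n'} (rel₀ : Rel s v z p)
             (transfer-E : ∀ ω → depthP ω ≤ e → _⊨ₛ_ (GraphLTS G g) v (E ω) → _⊨ₛ_ (GraphLTS G' g') p (E ω))
             (C : Characteristic) (a₀ : Asg φ) (val : Val φ s a₀) (c : X {φ})
             (stem : Star (XStep φ) ((s , a₀) , v) c) (loop : Star⁺ (XStep φ) c c)
             (fair : FairAll φ λ F → AnyEdge (λ x _ → F (proj₁ (proj₁ x)) (proj₂ (proj₁ x))) (⁺⇒* loop)) where

      move : ∀ {x y} → XStep φ x y → proj₂ x ≡ proj₂ y ⊎ Edge (proj₂ x) (proj₂ y) ≡ true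
      move xs = by-move (XStep.move xs)
        where
        by-move : ∀ {s s' v v'} → TokStep s s' v v' → v ≡ v' ⊎ Edge v v' ≡ true
        by-move (internal _ _ _ _)  = inj₁ refl
        by-move (pass edge _ _ _) = inj₂ edge

      loop-inv : Inv (proj₁ (proj₁ c)) (proj₂ c)
      loop-inv = XStep.inv (Star⁺.first loop)

      matching : Matched (holder {φ}) stem loop p
      matching = matched (holder {φ}) C move stem loop
        (S.cycle-passes (λ x → proj₁ (proj₁ x)) (holder {φ}) XStep.move (S.live loop-inv) loop) transfer-E

      open Matched matching

      -- At the beginning of a lap the left side is at `c` again, but the global state on the right
      -- may be new each time. The joint run is therefore produced lap by lap and need not be a
      -- lasso.
      Checkpoint : Set
      Checkpoint = Σ K λ κ → ∃[ z ] Rel (proj₁ (proj₁ c)) (proj₂ c) z (place κ)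

      lap-sim : ((κ , z , _) : Checkpoint) → Simulated {φ} (⁺⇒* (loop' κ)) (lap κ) z
      lap-sim (κ , _ , rel) = simulate (lap κ) rel

      stem-sim : Simulated {φ} stem' into z
      stem-sim = simulate into rel₀

      st-joint : Checkpoint → Joint {φ}
      st-joint (κ , z , _) = c , z , place κ

      next-point : Checkpoint → Checkpoint
      next-point q@(κ , _ , _) = next κ , Simulated.final (lap-sim q) , Simulated.rel' (lap-sim q)

      nonempty : ∀ {J : Set} {R : J → J → Set} {Q : J → J → Set} {x y} (w : Star R x y) → AnyEdge Q w →
                 Σ (Star⁺ R x y) λ w' → ⁺⇒* w' ≡ w
      nonempty (r ◅ w) _ = r ◂ w , refl

      -- The genuine step in each lap makes its joint walk nonempty, as `Unfold` requires.
      lap-walk : ∀ q → Σ (Star⁺ (JStep {φ}) (st-joint q) (st-joint (next-point q))) λ w →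
                 ⁺⇒* w ≡ Simulated.walk (lap-sim q)
      lap-walk q = nonempty (Simulated.walk (lap-sim q)) (Simulated.real (lap-sim q) (goes (proj₁ q)))

      open Unfold st-joint next-point (λ q → proj₁ (lap-walk q))

      start : Config
      start = config (k₀ , Simulated.final stem-sim , Simulated.rel' stem-sim) _ (Simulated.walk stem-sim)

      nodes : ℕ → Node φ
      nodes i = proj₁ (proj₁ (at start i))

      zs : ℕ → VState'
      zs i = proj₁ (proj₂ (at start i))

      linked : ∀ i → Linked φ (proj₁ (nodes i)) (proj₂ (nodes i)) (proj₂ (nodes (suc i)))
      linked i = by-step (JStep.left (edge (run start i)))
        where
        by-step : ∀ {x y : X {φ}} → x ≡ y ⊎ XStep φ x y →
             Linked φ (proj₁ (proj₁ x)) (proj₂ (proj₁ x)) (proj₂ (proj₁ y))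
        by-step (inj₁ refl) = linked-refl φ _ _
        by-step (inj₂ xs)   = proj₂ (proj₂ (XStep.tstep xs))

      fair-run : FairAll φ λ F → ∀ i → Eventually (λ j → F (proj₁ (nodes j)) (proj₂ (nodes j))) i
      fair-run = fair-map φ (λ F a → visits start {Q = AtX {φ} λ x → F (proj₁ (proj₁ x)) (proj₂ (proj₁ x))}
        λ q → subst (AnyEdge _) (sym (proj₂ (lap-walk q)))
                (Simulated.keeps (lap-sim q) {λ x → F (proj₁ (proj₁ x)) (proj₂ (proj₁ x))} (keeps (proj₁ q) a))) fair

      -- The tableau gives `φ` over the left states, stutters included; related states agree on the
      -- leaves of `φ`, so it holds over `zs`, and `Collapse` removes the stutters of the right
      -- side.
      joint⇒E : _⊨ₛ_ VProj' z (E φ)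
      joint⇒E = Collapse.holds⇒E VProj' zs (λ i → JStep.right (edge (run start i)))
        (visits start {Q = Real {φ}} λ q → subst (AnyEdge _) (sym (proj₂ (lap-walk q)))
          (Simulated.real (lap-sim q) (goes (proj₁ q))))
        φ
        (to (holds-cong φ (leaves-≤ (λ χ le i → agree χ le (JStep.rel (edge (run start i)))) φ φ-depth) 0)
          (to (truth φ (λ i → proj₁ (nodes i)) (λ i → proj₂ (nodes i))
                (λ i → JStep.consistent (edge (run start i))) linked fair-run 0) val))

    E-transfer : ∀ {s v z p} → Rel s v z p →
      (∀ ω → depthP ω ≤ e → _⊨ₛ_ (GraphLTS G g) v (E ω) → _⊨ₛ_ (GraphLTS G' g') p (E ω)) →
      _⊨ₛ_ VProj s (E φ) → _⊨ₛ_ VProj' z (E φ)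
    E-transfer {s} {v} {z} rel transfer-E (π , refl , sat) =
      decidable-stable (Tableau._⊨?_ VProj' S'.vstate-finite S'.vstep? z (E φ))
        (E⇒good φ S.vstate-finite π sat >>= λ good →
         characteristic >>= λ C → return (from-lasso C (good⇒lasso good)))
      where
      from-lasso : Characteristic → Lasso φ s → _⊨ₛ_ VProj' z (E φ)
      from-lasso C l =
        let v' , inv' , stem' , _ = S.annotate {φ} stem (inv rel)
            loop' , keep         = S.annotate-loop {φ} loop inv'
        in joint⇒E rel transfer-E C asg val (node , v') stem' loop' (fair-map φ keep fair)
        where open Lasso l

-- Induction on the nesting depth and the initial states.

module _ {AP : Set} (P : ProcTemplate AP) {k : ℕ} where

  -- Induction on `e` and then on `χ`. For `E φ` the relation is weakened to level `e`, and the
  -- level above is spent on the formulas `E ω` that produce the matching walk. The topologies are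
  -- arguments of the induction because the converse direction exchanges them.
  sat-agree : ∀ e (G : Topology) (g : Fin k → Fin (Topology.n G)) (g-inj : Injective _≡_ _≡_ g)
              (G' : Topology) (g' : Fin k → Fin (Topology.n G')) (g'-inj : Injective _≡_ _≡_ g') →
              ∀ χ → depthS χ ≤ e → ∀ {s v z p} → Simulation.Rel P G g g-inj G' g' g'-inj e s v z p →
              _⊨ₛ_ (System.VProj P G g) s χ ⇔ _⊨ₛ_ (System.VProj P G' g') z χ
  sat-agree e G g g-inj G' g' g'-inj tt       le rel = mk⇔ id id
  sat-agree e G g g-inj G' g' g'-inj (atom (p , i)) le rel =
    mk⇔ (subst (λ q → λP q p ≡ true) (obs i)) (subst (λ q → λP q p ≡ true) (sym (obs i)))
    where open Simulation.Rel rel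
          open ProcTemplate P
  sat-agree e G g g-inj G' g' g'-inj (¬ₛ χ)   le rel = mk⇔ (λ n h → n (from ih h)) (λ n h → n (to ih h))
    where ih = sat-agree e G g g-inj G' g' g'-inj χ le rel
  sat-agree e G g g-inj G' g' g'-inj (χ ∧ₛ ξ) le rel =
    mk⇔ (λ (a , b) → to ih₁ a , to ih₂ b) (λ (a , b) → from ih₁ a , from ih₂ b)
    where ih₁ = sat-agree e G g g-inj G' g' g'-inj χ (m⊔n≤o⇒m≤o _ _ le) rel
          ih₂ = sat-agree e G g g-inj G' g' g'-inj ξ (m⊔n≤o⇒n≤o _ _ le) rel
  sat-agree (suc e) G g g-inj G' g' g'-inj (E φ) (s≤s le) rel = mk⇔
    (Simulation.E-transfer P G g g-inj G' g' g'-inj e (sat-agree e G g g-inj G' g' g'-inj) φ le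
      (record { inv = inv ; inv' = inv' ; obs = obs ; near = λ χ le → near χ (≤-trans le (n≤1+n e)) })
      (λ ω le → to (near (E ω) (s≤s le))))
    (Simulation.E-transfer P G' g' g'-inj G g g-inj e (sat-agree e G' g' g'-inj G g g-inj) φ le
      (record { inv = inv' ; inv' = inv ; obs = λ i → sym (obs i)
              ; near = λ χ le → ⇔-sym (near χ (≤-trans le (n≤1+n e))) })
      (λ ω le → from (near (E ω) (s≤s le))))
    where open Simulation.Rel rel

  initial-agree : ∀ (G : Topology) (g : Fin k → Fin (Topology.n G))
                  (G' : Topology) (g' : Fin k → Fin (Topology.n G')) →
                  (∀ i → (g i == Topology.x G) ≡ true ⇔ (g' i == Topology.x G') ≡ true) →
                  ∀ i → GInit P G (g i) ≡ GInit P G' (g' i)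
  initial-agree G g G' g' eq i with g i == Topology.x G | g' i == Topology.x G' | eq i
  ... | true  | true  | _ = refl
  ... | false | false | _ = refl
  ... | true  | false | h = contradiction (to h refl) (λ ())
  ... | false | true  | h = contradiction (from h refl) (λ ())

theorem6 : (AP : Set) (d k : ℕ) (G G' : Topology) (P : ProcTemplate AP)
    (g : Fin k → Fin (Topology.n G)) (g' : Fin k → Fin (Topology.n G')) →
    Injective _≡_ _≡_ g → Injective _≡_ _≡_ g' →
    CTLd-equiv d (GraphLTS G g) (GraphLTS G' g') →
    CTLd-equiv d (Proj P G g) (Proj P G' g')
theorem6 AP d k G G' P g g' g-inj g'-inj equiv χ le =
  mk⇔ (from (S'.vec-Sat χ) ∘ to agree ∘ to (S.vec-Sat χ)) (from (S.vec-Sat χ) ∘ from agree ∘ to (S'.vec-Sat χ))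
  where
  module S  = System P G g
  module S' = System P G' g'

  agree : Sat S.VProj χ ⇔ Sat S'.VProj χ
  agree = sat-agree P d G g g-inj G' g' g'-inj χ le (record
    { inv  = S.inv-init
    ; inv' = S'.inv-init
    ; obs  = λ i → trans (lookup∘tabulate (GInit P G) (g i))
               (trans (initial-agree P G g G' g' (λ i → equiv (atom i) z≤n) i)
                      (sym (lookup∘tabulate (GInit P G') (g' i))))
    ; near = equiv
    })
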